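{- Let $\Delta_n$ be a permissible uniform flag complex on the vertex set $V_n$ such that pairs of arrows of type $THTH$ do not nest. Then the restriction $\Delta_n^+$ of $\Delta_n$ to the set of forward arrows (the subcomplex of faces consisting only of forward arrows) represents a triangulation of the union of those boundary facets of the positive root polytope $P_n^+$ that do not contain the origin.
   Context: Let $e_1,\dots,e_{n+1}$ be the standard basis of $\mathbb{R}^{n+1}$. The root polytope $P_n$ is the convex hull of the points $e_j-e_i$, $i\ne j$; the positive root polytope $P_n^+$ is the convex hull of the origin and the points $e_j-e_i$ with $1\le i<j\le n+1$. An arrow is an ordered pair $(i,j)$, $i\neq j$ in $\{1,\dots,n+1\}$ (tail $i$, head $j$), identified with the point $e_j-e_i$; it is forward if $i<j$ and backward if $i>j$. $V_n$ is the set of arrows. A set of arrows is admissible if contained in $I\times J$ for disjoint $I,J$. A simplicial complex $\Delta_n$ on $V_n$ is permissible if: (i) every face is admissible; (ii) every face is, as an undirected graph, a forest; (iii) for every three distinct $i,j,k$ the sets $\{(i,j),(i,k)\}$ and $\{(j,i),(k,i)\}$ are edges; for any two disjoint pairs $\{i_1,i_2\},\{j_1,j_2\}$ exactly one of $\{(i_1,j_1),(i_2,j_2)\}$, $\{(i_1,j_2),(i_2,j_1)\}$ is an edge; and the 2-skeleton is flag. A flag complex on $V_n$ is uniform if whether a pair $\{(i_1,j_1),(i_2,j_2)\}$ is an edge depends only on the equalities and inequalities among $i_1,i_2,j_1,j_2$. For two arrows with four distinct endpoints $p_1<p_2<p_3<p_4$, the type is the word recording $T$ (tail) or $H$ (head)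 for $p_1,\dots,p_4$ in order; the pair nests if its arrows join $\{p_1,p_4\}$ and $\{p_2,p_3\}$. "Pairs of type $THTH$ do not nest" means no nesting pair of type $THTH$ is an edge.
   Formalization: The geometry is carried out over the rational numbers: points of the polytope, convex weights, and the coefficients of facet inequalities are rational instead of real. -}

module Defs where

open import Data.Nat using (ℕ; suc) renaming (_≤_ to _≤ℕ_)
open import Data.Fin using (Fin; _<_; _≟_)
open import Data.Fin.Subset using (Subset; _∈_; _∉_)
open import Data.Bool using (if_then_else_)
open import Data.Rational using (ℚ; 0ℚ; 1ℚ; _+_; _*_; _-_; _≤_)
open import Data.Product using (Σ; ∃; _×_; _,_; proj₁; proj₂)
open import Data.Sum using (_⊎_)
open import Data.List using (List; []; _∷_; _++_; [_]; foldr; length; zipWith)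
open import Data.List.Relation.Unary.All using (All)
open import Data.List.Relation.Unary.AllPairs using (AllPairs)
open import Data.List.Relation.Unary.Linked using (Linked)
open import Data.List.Relation.Unary.Unique.Propositional using (Unique)
import Data.List.Membership.Propositional as Mem
open import Relation.Nullary using (¬_; does)
open import Relation.Binary.PropositionalEquality using (_≡_; _≢_)

Arrow : ℕ → Set
Arrow n = Fin (suc n) × Fin (suc n)

tail : ∀ {n} → Arrow n → Fin (suc n)
tail = proj₁

head : ∀ {n} → Arrow n → Fin (suc n)
head = proj₂

-- an element of V_n: tail ≠ head
IsArrow : ∀ {n} → Arrow n → Set
IsArrow a = tail a ≢ head a

Forward : ∀ {n} → Arrow n → Set
Forward a = tail a < head a

-- Flag complexes on V_n, given by their edge relation E.
-- Faces: finite sets (duplicate-free lists) of arrows, pairwise edges.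

IsFace : ∀ {n} → (Arrow n → Arrow n → Set) → List (Arrow n) → Set
IsFace E F = All IsArrow F × Unique F × AllPairs E F

Symmetric : ∀ {n} → (Arrow n → Arrow n → Set) → Set
Symmetric {n} E = ∀ (a b : Arrow n) → E a b → E b a

Admissible : ∀ {n} → List (Arrow n) → Set
Admissible {n} F = Σ (Subset (suc n)) λ I → Σ (Subset (suc n)) λ J →
  (∀ k → k ∈ I → k ∉ J) × All (λ a → (tail a ∈ I) × (head a ∈ J)) F

Adj : ∀ {n} → List (Arrow n) → Fin (suc n) → Fin (suc n) → Set
Adj F u v = Mem._∈_ (u , v) F ⊎ Mem._∈_ (v , u) F

HasCycle : ∀ {n} → List (Arrow n) → Set
HasCycle {n} F = Σ (Fin (suc n)) λ v → Σ (List (Fin (suc n))) λ vs →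
  (2 ≤ℕ length vs) × Unique (v ∷ vs) × Linked (Adj F) (v ∷ vs ++ [ v ])

Forest : ∀ {n} → List (Arrow n) → Set
Forest F = ¬ HasCycle F

ExactlyOne : Set → Set → Set
ExactlyOne A B = (A × ¬ B) ⊎ (¬ A × B)

-- permissible (the 2-skeleton being flag is automatic for a flag complex)
Permissible : ∀ {n} → (Arrow n → Arrow n → Set) → Set
Permissible {n} E =
  (∀ F → IsFace E F → Admissible F) ×
  (∀ F → IsFace E F → Forest F) ×
  (∀ (i j k : Fin (suc n)) → i ≢ j → i ≢ k → j ≢ k →
      E (i , j) (i , k) × E (j , i) (k , i)) ×
  (∀ (i₁ i₂ j₁ j₂ : Fin (suc n)) → i₁ ≢ i₂ → i₁ ≢ j₁ → i₁ ≢ j₂ →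
      i₂ ≢ j₁ → i₂ ≢ j₂ → j₁ ≢ j₂ →
      ExactlyOne (E (i₁ , j₁) (i₂ , j₂)) (E (i₁ , j₂) (i₂ , j₁)))

quad : ∀ {n} → Arrow n → Arrow n → Fin 4 → Fin (suc n)
quad a b Fin.zero = tail a
quad a b (Fin.suc Fin.zero) = tail b
quad a b (Fin.suc (Fin.suc Fin.zero)) = head a
quad a b (Fin.suc (Fin.suc (Fin.suc Fin.zero))) = head b

_⇔_ : Set → Set → Set
A ⇔ B = (A → B) × (B → A)

SameOrderType : ∀ {n} → (Fin 4 → Fin (suc n)) → (Fin 4 → Fin (suc n)) → Set
SameOrderType x y = ∀ p q → ((x p < x q) ⇔ (y p < y q)) × ((x p ≡ x q) ⇔ (y p ≡ y q))

Uniform : ∀ {n} → (Arrow n → Arrow n → Set) → Set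
Uniform {n} E = ∀ (a₁ a₂ b₁ b₂ : Arrow n) →
  IsArrow a₁ → IsArrow a₂ → IsArrow b₁ → IsArrow b₂ →
  SameOrderType (quad a₁ a₂) (quad b₁ b₂) → E a₁ a₂ → E b₁ b₂

THTHDoesNotNest : ∀ {n} → (Arrow n → Arrow n → Set) → Set
THTHDoesNotNest {n} E = ∀ (p₁ p₂ p₃ p₄ : Fin (suc n)) →
  p₁ < p₂ → p₂ < p₃ → p₃ < p₄ → ¬ E (p₁ , p₄) (p₃ , p₂)

Vec : ℕ → Set
Vec m = Fin m → ℚ

_≋_ : ∀ {m} → Vec m → Vec m → Set
x ≋ y = ∀ k → x k ≡ y k

zeroV : ∀ {m} → Vec m
zeroV _ = 0ℚ

sumℚ : List ℚ → ℚ
sumℚ = foldr _+_ 0ℚ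

dot : ∀ {m} → Vec m → Vec m → ℚ
dot {m} c x = sumℚ (Data.List.map (λ k → c k * x k) (Data.List.allFin m))

lincomb : ∀ {m} → List ℚ → List (Vec m) → Vec m
lincomb ls ps k = sumℚ (zipWith (λ l p → l * p k) ls ps)

InConv : ∀ {m} → List (Vec m) → Vec m → Set
InConv ps x = Σ (List ℚ) λ ls → (length ls ≡ length ps) × All (0ℚ ≤_) ls ×
  (sumℚ ls ≡ 1ℚ) × (lincomb ls ps ≋ x)

AffinelyIndependent : ∀ {m} → List (Vec m) → Set
AffinelyIndependent ps = ∀ ls → length ls ≡ length ps → sumℚ ls ≡ 0ℚ →
  lincomb ls ps ≋ zeroV → All (_≡ 0ℚ) ls

AffDim : ∀ {m} → (Vec m → Set) → ℕ → Set
AffDim {m} S d =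
  (Σ (List (Vec m)) λ ps → All S ps × length ps ≡ suc d × AffinelyIndependent ps) ×
  (∀ ps → All S ps → length ps ≡ suc (suc d) → ¬ AffinelyIndependent ps)

pt : ∀ {n} → Arrow n → Vec (suc n)
pt (i , j) k = (if does (k ≟ j) then 1ℚ else 0ℚ) - (if does (k ≟ i) then 1ℚ else 0ℚ)

IsGenP⁺ : ∀ {n} → Vec (suc n) → Set
IsGenP⁺ {n} v = (v ≋ zeroV) ⊎ (Σ (Arrow n) λ a → Forward a × (v ≋ pt a))

InP⁺ : ∀ {n} → Vec (suc n) → Set
InP⁺ {n} x = Σ (List (Vec (suc n))) λ ps → All IsGenP⁺ ps × InConv ps x

-- the face of P⁺_n cut out by the valid inequality ⟨c,·⟩ ≤ b : it is the
-- convex hull of the generators on the hyperplane ⟨c,·⟩ = b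
ValidIneq : ∀ {n} → Vec (suc n) → ℚ → Set
ValidIneq c b = ∀ v → IsGenP⁺ v → dot c v ≤ b

FaceGen : ∀ {n} → Vec (suc n) → ℚ → Vec (suc n) → Set
FaceGen c b v = IsGenP⁺ v × (dot c v ≡ b)

InFace : ∀ {n} → Vec (suc n) → ℚ → Vec (suc n) → Set
InFace {n} c b x = Σ (List (Vec (suc n))) λ ps → All (FaceGen c b) ps × InConv ps x

IsFacet : ∀ {n} → Vec (suc n) → ℚ → Set
IsFacet {n} c b = ValidIneq c b × Σ ℕ λ d → AffDim (IsGenP⁺ {n}) (suc d) × AffDim (FaceGen c b) d

InOuterBoundary : ∀ {n} → Vec (suc n) → Set
InOuterBoundary {n} x = Σ (Vec (suc n)) λ c → Σ ℚ λ b →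
  IsFacet c b × ¬ InFace c b zeroV × InFace c b x

-- Δ⁺ represents a triangulation of X: the simplices conv(F), F a face of
-- Δ⁺, are geometric simplices, lie in X, cover X, and intersect in
-- common faces (conv F ∩ conv G = conv (F ∩ G)).

IsFace⁺ : ∀ {n} → (Arrow n → Arrow n → Set) → List (Arrow n) → Set
IsFace⁺ E F = IsFace E F × All Forward F

simplex : ∀ {n} → List (Arrow n) → List (Vec (suc n))
simplex = Data.List.map pt

RepresentsTriangulation : ∀ {n} → (Arrow n → Arrow n → Set) →
  (Vec (suc n) → Set) → Set
RepresentsTriangulation {n} E X =
  (∀ F → IsFace⁺ E F → AffinelyIndependent (simplex F)) ×
  (∀ F → IsFace⁺ E F → ∀ x → InConv (simplex F) x → X x) ×
  (∀ x → X x → Σ (List (Arrow n)) λ F → IsFace⁺ E F × InConv (simplex F) x) ×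
  (∀ F G → IsFace⁺ E F → IsFace⁺ E G → ∀ x →
     InConv (simplex F) x → InConv (simplex G) x →
     Σ (List (Arrow n)) λ H →
       All (λ a → Mem._∈_ a F × Mem._∈_ a G) H × InConv (simplex H) x)

{-# OPTIONS --safe #-}

-- By uniformity all pairs of forward arrows of type TTHH cross, or all of them nest, while pairs
-- of type THTH are disjoint intervals.  Either way there is a priority order τ on tails such that
-- in a face no two arrows (i , j′), (i′ , j) have i before i′, j < j′ and i < j.  This makes the
-- weights of a point on a face unique: at the cell (i , j) of least rank where two weightings
-- differ, the lighter one must compensate further along row i and column j, using a forbidden
-- pair.  Affine independence and the intersection property follow.  Conversely, reading a point
-- of the outer boundary as a flow and scanning the vertices from left to right, each head consuming
-- the waiting tails in the order τ (a queue or a stack), produces a face containing the point.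

module Submission where

open import Defs
open import Data.Nat using (ℕ; zero; suc; z≤n; s≤s; _∸_)
  renaming (_<_ to _<ℕ_; _≤_ to _≤ℕ_; _+_ to _+ℕ_)
import Data.Nat.Properties as ℕ
open import Data.Fin using (Fin; zero; suc; _≟_; toℕ; inject₁; fromℕ; punchIn; punchOut)
  renaming (_<_ to _<ᶠ_)
import Data.Fin.Properties as Fin
open import Data.Fin.Subset using () renaming (_∈_ to _∈ₛ_)
open import Data.Rational
  using (ℚ; 0ℚ; 1ℚ; _+_; _*_; _-_; -_; _≤_; _<_; ∣_∣; 1/_; NonZero; ≢-nonZero; nonNegative)
open import Data.Rational.Properties hiding (_≟_; <-cmp; _<?_; _≤?_)
import Data.Rational.Properties as ℚ
open import Data.Rational.Solver using (module +-*-Solver)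
open import Data.List using (List; []; _∷_; map; length; zipWith; allFin; tabulate)
open import Data.List.Properties using (map-tabulate; length-map; length-tabulate)
open import Data.List.Relation.Unary.All as All using (All; []; _∷_)
import Data.List.Relation.Unary.All.Properties as All
open import Data.List.Relation.Unary.Any using (Any; here; there; any?)
open import Data.List.Relation.Unary.AllPairs as AllPairs using (AllPairs; []; _∷_)
open import Data.List.Relation.Unary.Unique.Propositional using (Unique)
import Data.List.Relation.Unary.Unique.Propositional.Properties as Unique
open import Data.List.Relation.Binary.Pointwise as Pointwise using (Pointwise; []; _∷_)
open import Data.List.Membership.Propositional using (_∈_; _∉_; find; lose)
open import Data.List.Membership.Propositional.Properties using (∈-allFin)
import Data.List.Membership.DecPropositional as DecMembership
open import Data.Bool using (Bool; true; false; if_then_else_)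
open import Data.Empty using (⊥)
open import Data.Product using (Σ; ∃; _×_; _,_; proj₁; proj₂)
open import Data.Product.Properties using (≡-dec)
open import Data.Sum using (_⊎_; inj₁; inj₂; swap)
open import Function using (_∘_; id)
open import Relation.Nullary using (does; yes; no; ¬_; contradiction; Dec)
open import Relation.Nullary.Decidable using (¬?; decidable-stable; _⊎-dec_; _×-dec_; dec-true; dec-false)
open import Relation.Binary using (tri<; tri≈; tri>; DecidableEquality)
open import Relation.Binary.PropositionalEquality
open +-*-Solver using (solve; _:=_; _:+_; _:*_; _:-_; :-_; con)

-- Weighted sums

-- In a face no vertex is both a head and a tail, so a point fixes the inflow and outflow as its
-- positive and negative parts. The weights then form a nonnegative matrix with prescribed row and
-- column sums. Nonnegativity is vital: a strict deficit must put an arrow into the other face.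
-- Affine independence concerns signed coefficients `l`, so it is reached by comparing the
-- nonnegative weights `∣ l ∣ + l` and `∣ l ∣`. For covering, the obstacle is that the scan
-- preserves the vector but not visibly the total weight: merging two consecutive arrows into one
-- would lower it. On an outer facet this cannot happen, because two consecutive tight arrows would
-- compose to an arrow beyond the supporting hyperplane. Hence some 0/1 functional has height 1 on
-- the old arrows and on the new ones. A facet is defined by its dimension, so a spanning tree must
-- supply independent points and Gaussian elimination the upper bounds.

wsum : {A : Set} → (A → ℚ) → List ℚ → List A → ℚ
wsum f ls as = sumℚ (zipWith (λ l a → l * f a) ls as)

wsum-cong : {A : Set} {f g : A → ℚ} (ls : List ℚ) {as : List A} →
  All (λ a → f a ≡ g a) as → wsum f ls as ≡ wsum g ls as
wsum-cong []       _          = refl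
wsum-cong (l ∷ ls) []         = refl
wsum-cong (l ∷ ls) (eq ∷ eqs) = cong₂ _+_ (cong (l *_) eq) (wsum-cong ls eqs)

wsum-cong′ : {A : Set} {f g : A → ℚ} (ls : List ℚ) (as : List A) →
  (∀ a → f a ≡ g a) → wsum f ls as ≡ wsum g ls as
wsum-cong′ []       _        _  = refl
wsum-cong′ (l ∷ ls) []       _  = refl
wsum-cong′ (l ∷ ls) (a ∷ as) eq = cong₂ _+_ (cong (l *_) (eq a)) (wsum-cong′ ls as eq)

wsum-0 : {A : Set} (ls : List ℚ) (as : List A) → wsum (λ _ → 0ℚ) ls as ≡ 0ℚ
wsum-0 []       _        = refl
wsum-0 (l ∷ ls) []       = refl
wsum-0 (l ∷ ls) (a ∷ as) = cong₂ _+_ (*-zeroʳ l) (wsum-0 ls as)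

wsum-+ : {A : Set} (f g : A → ℚ) (ls : List ℚ) (as : List A) →
  wsum (λ a → f a + g a) ls as ≡ wsum f ls as + wsum g ls as
wsum-+ f g []       _        = refl
wsum-+ f g (l ∷ ls) []       = refl
wsum-+ f g (l ∷ ls) (a ∷ as) = trans (cong (l * (f a + g a) +_) (wsum-+ f g ls as))
  (solve 5 (λ l p q s t → l :* (p :+ q) :+ (s :+ t) := (l :* p :+ s) :+ (l :* q :+ t)) refl
    l (f a) (g a) (wsum f ls as) (wsum g ls as))

wsum-- : {A : Set} (f g : A → ℚ) (ls : List ℚ) (as : List A) →
  wsum (λ a → f a - g a) ls as ≡ wsum f ls as - wsum g ls as
wsum-- f g []       _        = refl
wsum-- f g (l ∷ ls) []       = refl
wsum-- f g (l ∷ ls) (a ∷ as) = trans (cong (l * (f a - g a) +_) (wsum-- f g ls as))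
  (solve 5 (λ l p q s t → l :* (p :- q) :+ (s :- t) := (l :* p :+ s) :- (l :* q :+ t)) refl
    l (f a) (g a) (wsum f ls as) (wsum g ls as))

wsum-* : {A : Set} (c : ℚ) (f : A → ℚ) (ls : List ℚ) (as : List A) →
  wsum (λ a → c * f a) ls as ≡ c * wsum f ls as
wsum-* c f []       _        = sym (*-zeroʳ c)
wsum-* c f (l ∷ ls) []       = sym (*-zeroʳ c)
wsum-* c f (l ∷ ls) (a ∷ as) = trans (cong (l * (c * f a) +_) (wsum-* c f ls as))
  (solve 4 (λ c l p s → l :* (c :* p) :+ c :* s := c :* (l :* p :+ s)) refl
    c l (f a) (wsum f ls as))

wsum-mono : {A : Set} {f g : A → ℚ} {ls : List ℚ} {as : List A} →
  All (0ℚ ≤_) ls → All (λ a → f a ≤ g a) as → wsum f ls as ≤ wsum g ls as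
wsum-mono []           _        = ≤-refl
wsum-mono (l≥0 ∷ ls≥0) []       = ≤-refl
wsum-mono {ls = l ∷ _} (l≥0 ∷ ls≥0) (p ∷ ps) =
  +-mono-≤ (*-monoˡ-≤-nonNeg l {{nonNegative l≥0}} p) (wsum-mono ls≥0 ps)

wsum-const : {A : Set} (c : ℚ) (ls : List ℚ) (as : List A) → length ls ≡ length as →
  wsum (λ _ → c) ls as ≡ sumℚ ls * c
wsum-const c []       _        _  = sym (*-zeroˡ c)
wsum-const c (l ∷ ls) (a ∷ as) eq =
  trans (cong (l * c +_) (wsum-const c ls as (ℕ.suc-injective eq)))
    (sym (*-distribʳ-+ c l (sumℚ ls)))

wsum-map : {A B : Set} (f : B → ℚ) (g : A → B) (ls : List ℚ) (as : List A) →
  wsum f ls (map g as) ≡ wsum (f ∘ g) ls as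
wsum-map f g []       _        = refl
wsum-map f g (l ∷ ls) []       = refl
wsum-map f g (l ∷ ls) (a ∷ as) = cong (l * f (g a) +_) (wsum-map f g ls as)

wsum-abs : {A : Set} (f : A → ℚ) (ls : List ℚ) (as : List A) →
  wsum f (map (λ l → ∣ l ∣ + l) ls) as ≡ wsum f (map ∣_∣ ls) as + wsum f ls as
wsum-abs f []       _        = refl
wsum-abs f (l ∷ ls) []       = refl
wsum-abs f (l ∷ ls) (a ∷ as) = trans (cong ((∣ l ∣ + l) * f a +_) (wsum-abs f ls as))
  (solve 5 (λ k l p s t → (k :+ l) :* p :+ (s :+ t) := (k :* p :+ s) :+ (l :* p :+ t)) refl
    ∣ l ∣ l (f a) (wsum f (map ∣_∣ ls) as) (wsum f ls as))

sum-cong : {A : Set} {f g : A → ℚ} (ks : List A) → (∀ k → f k ≡ g k) →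
  sumℚ (map f ks) ≡ sumℚ (map g ks)
sum-cong []       _  = refl
sum-cong (k ∷ ks) eq = cong₂ _+_ (eq k) (sum-cong ks eq)

sum-0 : {A : Set} (ks : List A) → sumℚ (map (λ _ → 0ℚ) ks) ≡ 0ℚ
sum-0 []       = refl
sum-0 (k ∷ ks) = trans (+-identityˡ _) (sum-0 ks)

sum-mono-≤ : {A : Set} {f g : A → ℚ} (ks : List A) → (∀ k → f k ≤ g k) →
  sumℚ (map f ks) ≤ sumℚ (map g ks)
sum-mono-≤ []       _ = ≤-refl
sum-mono-≤ (k ∷ ks) p = +-mono-≤ (p k) (sum-mono-≤ ks p)

sum-mono-< : {A : Set} {f g : A → ℚ} {ks : List A} {k : A} → (∀ k → f k ≤ g k) →
  k ∈ ks → f k < g k → sumℚ (map f ks) < sumℚ (map g ks)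
sum-mono-< {ks = _ ∷ ks} p (here refl) fk<gk = +-mono-<-≤ fk<gk (sum-mono-≤ ks p)
sum-mono-< {ks = k ∷ _}  p (there k∈)  fk<gk = +-mono-≤-< (p k) (sum-mono-< p k∈ fk<gk)

sum-wsum : {A B : Set} (g : B → A → ℚ) (ls : List ℚ) (as : List A) (ks : List B) →
  sumℚ (map (λ k → wsum (g k) ls as) ks) ≡ wsum (λ a → sumℚ (map (λ k → g k a) ks)) ls as
sum-wsum g ls as []       = sym (wsum-0 ls as)
sum-wsum g ls as (k ∷ ks) = trans (cong (wsum (g k) ls as +_) (sum-wsum g ls as ks))
  (sym (wsum-+ (g k) _ ls as))

dot-wsum : ∀ {m} {A : Set} (c : Vec m) (g : Fin m → A → ℚ) (ls : List ℚ) (as : List A) →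
  dot c (λ k → wsum (g k) ls as) ≡ wsum (λ a → dot c (λ k → g k a)) ls as
dot-wsum {m} c g ls as =
  trans (sum-cong (allFin m) (λ k → sym (wsum-* (c k) (g k) ls as)))
    (sum-wsum (λ k a → c k * g k a) ls as (allFin m))

dot-cong : ∀ {m} (c : Vec m) {x y : Vec m} → x ≋ y → dot c x ≡ dot c y
dot-cong {m} c x≋y = sum-cong (allFin m) (λ k → cong (c k *_) (x≋y k))

dot-zeroV : ∀ {m} (c : Vec m) → dot c zeroV ≡ 0ℚ
dot-zeroV {m} c = trans (sum-cong (allFin m) (λ k → *-zeroʳ (c k))) (sum-0 (allFin m))

sum-suc : ∀ {m} (f : Fin (suc m) → ℚ) →
  sumℚ (map f (allFin (suc m))) ≡ f zero + sumℚ (map (f ∘ suc) (allFin m))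
sum-suc f = cong (λ xs → f zero + sumℚ xs)
  (trans (map-tabulate suc f) (sym (map-tabulate id (f ∘ suc))))

e : ∀ {m} → Fin m → Vec m
e i k = if does (k ≟ i) then 1ℚ else 0ℚ

dot-e : ∀ {m} (c : Vec m) (i : Fin m) → dot c (e i) ≡ c i
dot-e c zero    = trans (sum-suc (λ k → c k * e zero k))
  (trans (cong₂ _+_ (*-identityʳ (c zero)) (dot-zeroV (c ∘ suc))) (+-identityʳ (c zero)))
dot-e c (suc i) = trans (sum-suc (λ k → c k * e (suc i) k))
  (trans (cong₂ _+_ (*-zeroʳ (c zero)) (dot-e (c ∘ suc) i)) (+-identityˡ (c (suc i))))

-- A difference of two vectors, seen as a linear combination with weights 1 and -1.
dot-pt : ∀ {n} (c : Vec (suc n)) (a : Arrow n) → dot c (pt a) ≡ c (head a) - c (tail a)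
dot-pt c (i , j) = begin
  dot c (pt (i , j))
    ≡⟨ dot-cong c (λ k → solve 2 (λ p q → p :- q := con 1ℚ :* p :+ (con (- 1ℚ) :* q :+ con 0ℚ)) refl
         (e j k) (e i k)) ⟩
  dot c (λ k → wsum (λ t → e t k) (1ℚ ∷ - 1ℚ ∷ []) (j ∷ i ∷ []))
    ≡⟨ dot-wsum c (λ k t → e t k) (1ℚ ∷ - 1ℚ ∷ []) (j ∷ i ∷ []) ⟩
  1ℚ * dot c (e j) + (- 1ℚ * dot c (e i) + 0ℚ)
    ≡⟨ cong₂ (λ p q → 1ℚ * p + (- 1ℚ * q + 0ℚ)) (dot-e c j) (dot-e c i) ⟩
  1ℚ * c j + (- 1ℚ * c i + 0ℚ)
    ≡⟨ solve 2 (λ p q → con 1ℚ :* p :+ (con (- 1ℚ) :* q :+ con 0ℚ) := p :- q) refl (c j) (c i) ⟩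
  c j - c i ∎
  where open ≡-Reasoning

-- Uniqueness of weights

e-refl : ∀ {m} (i : Fin m) → e i i ≡ 1ℚ
e-refl i with i ≟ i
... | yes _  = refl
... | no i≢i = contradiction refl i≢i

e-≢ : ∀ {m} {i k : Fin m} → k ≢ i → e i k ≡ 0ℚ
e-≢ {i = i} {k} k≢i with k ≟ i
... | yes k≡i = contradiction k≡i k≢i
... | no _    = refl

0≤1 : 0ℚ ≤ 1ℚ
0≤1 = nonNegative⁻¹ 1ℚ

e≥0 : ∀ {m} (i k : Fin m) → 0ℚ ≤ e i k
e≥0 i k with k ≟ i
... | yes _ = 0≤1
... | no _  = ≤-refl

*-nonNeg : ∀ {p q} → 0ℚ ≤ p → 0ℚ ≤ q → 0ℚ ≤ p * q
*-nonNeg {p} p≥0 q≥0 =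
  ≤-trans (≤-reflexive (sym (*-zeroʳ p))) (*-monoˡ-≤-nonNeg p {{nonNegative p≥0}} q≥0)

wsum-nonNeg : {A : Set} {f : A → ℚ} {ls : List ℚ} {as : List A} →
  All (0ℚ ≤_) ls → All (λ a → 0ℚ ≤ f a) as → 0ℚ ≤ wsum f ls as
wsum-nonNeg {ls = ls} {as} ls≥0 p = ≤-trans (≤-reflexive (sym (wsum-0 ls as))) (wsum-mono ls≥0 p)

_≟ᴬ_ : ∀ {n} → DecidableEquality (Arrow n)
_≟ᴬ_ = ≡-dec _≟_ _≟_

e-product : ∀ {n} {a : Arrow n} {i j} → (i , j) ≢ a → e (tail a) i * e (head a) j ≡ 0ℚ
e-product {a = t , h} {i} {j} ij≢a = cases (i ≟ t) (j ≟ h)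
  where
  cases : Dec (i ≡ t) → Dec (j ≡ h) → e t i * e h j ≡ 0ℚ
  cases (no i≢t)   _          = trans (cong (_* e h j) (e-≢ i≢t)) (*-zeroˡ (e h j))
  cases (yes _)    (no j≢h)   = trans (cong (e t i *_) (e-≢ j≢h)) (*-zeroʳ (e t i))
  cases (yes refl) (yes refl) = contradiction refl ij≢a

total : ∀ {m} → Vec m → ℚ
total {m} f = sumℚ (map f (allFin m))

total-deficit : ∀ {m} (f g : Vec m) {k : Fin m} → total f ≡ total g → g k < f k →
  ∃ λ k′ → f k′ < g k′
total-deficit f g {k} eq gk<fk with Fin.any? (λ k′ → f k′ ℚ.<? g k′)
... | yes found = found
... | no none   = contradiction
  (sum-mono-< (λ k′ → ≮⇒≥ (λ lt → none (k′ , lt))) (∈-allFin k) gk<fk)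
  (<-irrefl (sym eq))

-- The matrix of a weighting, with tails as rows and heads as columns. Cells off the list hold 0, so
-- weightings carried by different lists can be compared entry by entry.
wt : ∀ {n} → List ℚ → List (Arrow n) → Fin (suc n) → Fin (suc n) → ℚ
wt ls F i j = wsum (λ a → e (tail a) i * e (head a) j) ls F

outflow : ∀ {n} → List ℚ → List (Arrow n) → Vec (suc n)
outflow ls F i = wsum (λ a → e (tail a) i) ls F

inflow : ∀ {n} → List ℚ → List (Arrow n) → Vec (suc n)
inflow ls F j = wsum (λ a → e (head a) j) ls F

comb : ∀ {n} → List ℚ → List (Arrow n) → Vec (suc n)
comb ls F k = wsum (λ a → pt a k) ls F

module _ {n : ℕ} (ls : List ℚ) (F : List (Arrow n)) where

  wt-row : ∀ i → total (wt ls F i) ≡ outflow ls F i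
  wt-row i = trans (sum-wsum _ ls F (allFin (suc n)))
    (wsum-cong′ ls F (λ a → dot-e (λ _ → e (tail a) i) (head a)))

  wt-column : ∀ j → total (λ i → wt ls F i j) ≡ inflow ls F j
  wt-column j = trans (sum-wsum _ ls F (allFin (suc n)))
    (wsum-cong′ ls F (λ a → trans
      (sum-cong (allFin (suc n)) (λ i → *-comm (e (tail a) i) (e (head a) j)))
      (dot-e (λ _ → e (head a) j) (tail a))))

  wt-∉ : ∀ {i j} → (i , j) ∉ F → wt ls F i j ≡ 0ℚ
  wt-∉ {i} {j} ∉F = trans
    (wsum-cong ls (All.tabulate (λ {a} a∈F → e-product {a = a} {i} {j} (λ { refl → ∉F a∈F }))))
    (wsum-0 ls F)

  wt>0⇒∈ : ∀ {i j} → 0ℚ < wt ls F i j → (i , j) ∈ F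
  wt>0⇒∈ {i} {j} pos with (i , j) ∈? F
    where open DecMembership _≟ᴬ_ using (_∈?_)
  ... | yes ∈F = ∈F
  ... | no ∉F  = contradiction pos (<-irrefl (sym (wt-∉ ∉F)))

  wt≥0 : All (0ℚ ≤_) ls → ∀ i j → 0ℚ ≤ wt ls F i j
  wt≥0 ls≥0 i j = wsum-nonNeg ls≥0
    (All.universal (λ a → *-nonNeg (e≥0 (tail a) i) (e≥0 (head a) j)) F)

wt-coeff : ∀ {n} {ls : List ℚ} {F : List (Arrow n)} → Unique F → length ls ≡ length F →
  Pointwise (λ l a → wt ls F (tail a) (head a) ≡ l) ls F
wt-coeff {ls = []}     {[]}    _               _  = []
wt-coeff {ls = l ∷ ls} {a ∷ F} (a∉F ∷ uniqueF) eq =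
  trans (cong₂ _+_ (cong (l *_) (cong₂ _*_ (e-refl (tail a)) (e-refl (head a))))
    (wt-∉ ls F (All.All¬⇒¬Any a∉F)))
    (trans (+-identityʳ _) (*-identityʳ l))
  ∷ shift a∉F (wt-coeff uniqueF (ℕ.suc-injective eq))
  where
  shift : ∀ {G ms} → All (a ≢_) G →
    Pointwise (λ m b → wt ls F (tail b) (head b) ≡ m) ms G →
    Pointwise (λ m b → wt (l ∷ ls) (a ∷ F) (tail b) (head b) ≡ m) ms G
  shift []           []         = []
  shift (a≢b ∷ a≢G) (eqb ∷ eqs) =
    trans (cong₂ _+_ (trans (cong (l *_) (e-product {a = a} (a≢b ∘ sym))) (*-zeroʳ l)) eqb) (+-identityˡ _)
    ∷ shift a≢G eqs

-- What uniqueness needs from a face, freed from the edge relation, so that it also applies to the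
-- spanning trees used for dimensions. The pair forbidden in `uncrossed` arises from `(i , j)` and
-- `(i′ , j′)` by exchanging heads; `i <ᶠ j` makes `(i , j)` forward.
record Uncrossed {n : ℕ} (τ : Fin (suc n) → ℕ) (F : List (Arrow n)) : Set where
  field
    forward     : All Forward F
    alternating : ∀ {a b} → a ∈ F → b ∈ F → head a ≢ tail b
    uncrossed   : ∀ {i i′ j j′} → τ i <ℕ τ i′ → i <ᶠ j → j <ᶠ j′ →
                  (i , j′) ∈ F → (i′ , j) ∈ F → ⊥

open Uncrossed

comb-balance : ∀ {n} (ls : List ℚ) (F : List (Arrow n)) k → comb ls F k ≡ inflow ls F k - outflow ls F k
comb-balance ls F k = wsum-- (λ a → e (head a) k) (λ a → e (tail a) k) ls F

module _ {n : ℕ} {τ : Fin (suc n) → ℕ} {F : List (Arrow n)} (U : Uncrossed τ F) (ls : List ℚ) where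

  inflow-or-outflow-zero : ∀ k → inflow ls F k ≡ 0ℚ ⊎ outflow ls F k ≡ 0ℚ
  inflow-or-outflow-zero k with any? (λ a → k ≟ head a) F
  ... | no none = inj₁ (trans
    (wsum-cong ls (All.map (λ {a} k≢ → e-≢ {i = head a} k≢) (All.¬Any⇒All¬ F none)))
    (wsum-0 ls F))
  ... | yes some with find some
  ... | (b , b∈F , refl) = inj₂ (trans
    (wsum-cong ls (All.tabulate (λ {a} a∈F → e-≢ {i = tail a} (alternating U b∈F a∈F))))
    (wsum-0 ls F))

-- If `p` or `q` is 0, then `p` is the positive part of `p - q`, the least possible minuend. Used in
-- both directions, this shows that two uncrossed families representing the same point have equal
-- inflows.
difference-mono : ∀ {p q p′ q′} → p - q ≡ p′ - q′ → p ≡ 0ℚ ⊎ q ≡ 0ℚ → 0ℚ ≤ p′ → 0ℚ ≤ q′ → p ≤ p′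
difference-mono eq (inj₁ refl) p′≥0 _ = p′≥0
difference-mono {p} {q} {p′} {q′} eq (inj₂ refl) _ q′≥0 = begin
  p        ≡⟨ solve 1 (λ p → p := p :- con 0ℚ) refl p ⟩
  p - 0ℚ   ≡⟨ eq ⟩
  p′ - q′  ≤⟨ +-monoʳ-≤ p′ (neg-antimono-≤ q′≥0) ⟩
  p′ - 0ℚ  ≡⟨ solve 1 (λ p → p :- con 0ℚ := p) refl p′ ⟩
  p′       ∎
  where open ≤-Reasoning

module _ {n : ℕ} {τ : Fin (suc n) → ℕ} (τ-injective : ∀ {i j} → τ i ≡ τ j → i ≡ j) where

  module _ {F G : List (Arrow n)} (UF : Uncrossed τ F) (UG : Uncrossed τ G)
           {ls ms : List ℚ} (ls≥0 : All (0ℚ ≤_) ls) (ms≥0 : All (0ℚ ≤_) ms)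
           (inflow≡ : ∀ k → inflow ls F k ≡ inflow ms G k)
           (outflow≡ : ∀ k → outflow ls F k ≡ outflow ms G k) where

    -- The rank `τ i +ℕ toℕ j` drops when one moves to an earlier cell of the same row or column,
    -- and only such cells are consulted. The excess puts `(i , j)` into `F`, whence `i <ᶠ j`; the
    -- two deficits put the forbidden pair into `G`.
    no-excess : ∀ i j →
      (∀ i′ j′ → τ i′ +ℕ toℕ j′ <ℕ τ i +ℕ toℕ j → wt ls F i′ j′ ≡ wt ms G i′ j′) →
      ¬ (wt ms G i j < wt ls F i j)
    no-excess i j below excess
      with total-deficit (wt ls F i) (wt ms G i) {j}
             (trans (wt-row ls F i) (trans (outflow≡ i) (sym (wt-row ms G i)))) excess
         | total-deficit (λ i → wt ls F i j) (λ i → wt ms G i j) {i}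
             (trans (wt-column ls F j) (trans (inflow≡ j) (sym (wt-column ms G j)))) excess
    ... | j′ , rowDeficit | i′ , columnDeficit = uncrossed UG below-i′ i<j right-of-j
      (wt>0⇒∈ ms G (≤-<-trans (wt≥0 ls F ls≥0 i j′) rowDeficit))
      (wt>0⇒∈ ms G (≤-<-trans (wt≥0 ls F ls≥0 i′ j) columnDeficit))
      where
      i<j : i <ᶠ j
      i<j = All.lookup (forward UF) (wt>0⇒∈ ls F (≤-<-trans (wt≥0 ms G ms≥0 i j) excess))

      right-of-j : j <ᶠ j′
      right-of-j with Fin.<-cmp j j′
      ... | tri< lt _ _   = lt
      ... | tri≈ _ refl _ = contradiction excess (<-asym rowDeficit)
      ... | tri> _ _ gt   = contradiction rowDeficit
        (<-irrefl (below i j′ (ℕ.+-monoʳ-< (τ i) gt)))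

      below-i′ : τ i <ℕ τ i′
      below-i′ with ℕ.<-cmp (τ i) (τ i′)
      ... | tri< lt _ _ = lt
      ... | tri> _ _ gt = contradiction columnDeficit
        (<-irrefl (below i′ j (ℕ.+-monoˡ-< (toℕ j) gt)))
      ... | tri≈ _ eq _ with refl ← τ-injective eq = contradiction excess (<-asym columnDeficit)

  wt-unique-below : ∀ {F G : List (Arrow n)} → Uncrossed τ F → Uncrossed τ G →
    ∀ {ls ms} → All (0ℚ ≤_) ls → All (0ℚ ≤_) ms →
    (∀ k → inflow ls F k ≡ inflow ms G k) → (∀ k → outflow ls F k ≡ outflow ms G k) →
    ∀ r i j → τ i +ℕ toℕ j <ℕ r → wt ls F i j ≡ wt ms G i j
  wt-unique-below {F} {G} UF UG {ls} {ms} ls≥0 ms≥0 inflow≡ outflow≡ (suc r) i j (s≤s rank≤r) =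
    compare (ℚ.<-cmp (wt ls F i j) (wt ms G i j))
    where
    below : ∀ i′ j′ → τ i′ +ℕ toℕ j′ <ℕ τ i +ℕ toℕ j → wt ls F i′ j′ ≡ wt ms G i′ j′
    below i′ j′ lt = wt-unique-below UF UG ls≥0 ms≥0 inflow≡ outflow≡ r i′ j′ (ℕ.<-≤-trans lt rank≤r)
    compare : _ → wt ls F i j ≡ wt ms G i j
    compare (tri≈ _ eq _) = eq
    compare (tri< lt _ _) = contradiction lt
      (no-excess UG UF ms≥0 ls≥0 (sym ∘ inflow≡) (sym ∘ outflow≡) i j (λ i′ j′ p → sym (below i′ j′ p)))
    compare (tri> _ _ gt) = contradiction gt
      (no-excess UF UG ls≥0 ms≥0 inflow≡ outflow≡ i j below)

  wt-unique : ∀ {F G : List (Arrow n)} → Uncrossed τ F → Uncrossed τ G →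
    ∀ {ls ms} → All (0ℚ ≤_) ls → All (0ℚ ≤_) ms → comb ls F ≋ comb ms G →
    ∀ i j → wt ls F i j ≡ wt ms G i j
  wt-unique {F} {G} UF UG {ls} {ms} ls≥0 ms≥0 comb≡ i j =
    wt-unique-below UF UG ls≥0 ms≥0 inflow≡ outflow≡ _ i j (ℕ.n<1+n _)
    where
    balance : ∀ k → inflow ls F k - outflow ls F k ≡ inflow ms G k - outflow ms G k
    balance k = trans (sym (comb-balance ls F k)) (trans (comb≡ k) (comb-balance ms G k))
    inflow≥0 : ∀ (H : List (Arrow n)) {ks} → All (0ℚ ≤_) ks → ∀ k → 0ℚ ≤ inflow ks H k
    inflow≥0 H ks≥0 k = wsum-nonNeg ks≥0 (All.universal (λ a → e≥0 (head a) k) H)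
    outflow≥0 : ∀ (H : List (Arrow n)) {ks} → All (0ℚ ≤_) ks → ∀ k → 0ℚ ≤ outflow ks H k
    outflow≥0 H ks≥0 k = wsum-nonNeg ks≥0 (All.universal (λ a → e≥0 (tail a) k) H)
    inflow≡ : ∀ k → inflow ls F k ≡ inflow ms G k
    inflow≡ k = ≤-antisym
      (difference-mono (balance k) (inflow-or-outflow-zero UF ls k) (inflow≥0 G ms≥0 k) (outflow≥0 G ms≥0 k))
      (difference-mono (sym (balance k)) (inflow-or-outflow-zero UG ms k)
        (inflow≥0 F ls≥0 k) (outflow≥0 F ls≥0 k))
    outflow≡ : ∀ k → outflow ls F k ≡ outflow ms G k
    outflow≡ k = neg-injective (+-cancelˡ (inflow ls F k)
      (trans (balance k) (cong (_- outflow ms G k) (sym (inflow≡ k)))))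
      where
      +-cancelˡ : ∀ p {q r} → p + q ≡ p + r → q ≡ r
      +-cancelˡ p {q} {r} eq = trans (solve 2 (λ p q → q := :- p :+ (p :+ q)) refl p q)
        (trans (cong (- p +_) eq) (solve 2 (λ p r → :- p :+ (p :+ r) := r) refl p r))

  -- Since `ls` represents zero, `∣ l ∣ + l` and `∣ l ∣` are nonnegative weightings of one and the
  -- same vector; their matrices agree, and the difference is the matrix of `ls`. This gives linear
  -- independence, so the origin can later be added as a further vertex.
  uncrossed-independent : ∀ {F : List (Arrow n)} → Uncrossed τ F → Unique F →
    ∀ ls → length ls ≡ length F → comb ls F ≋ zeroV → All (_≡ 0ℚ) ls
  uncrossed-independent {F} U uniqueF ls len comb≡0 = zeros (wt-coeff uniqueF len)
    where
    0≤∣l∣+l : ∀ l → 0ℚ ≤ ∣ l ∣ + l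
    0≤∣l∣+l l with ≤-total 0ℚ l
    ... | inj₁ l≥0 = +-mono-≤ (0≤∣p∣ l) l≥0
    ... | inj₂ l≤0 = ≤-reflexive (sym (trans
      (cong (_+ l) (trans (sym (∣-p∣≡∣p∣ l)) (0≤p⇒∣p∣≡p (neg-antimono-≤ l≤0)))) (+-inverseˡ l)))
    wt≡0 : ∀ i j → wt ls F i j ≡ 0ℚ
    wt≡0 i j = begin
      wt ls F i j
        ≡⟨ solve 2 (λ a w → w := (a :+ w) :- a) refl (wt (map ∣_∣ ls) F i j) (wt ls F i j) ⟩
      (wt (map ∣_∣ ls) F i j + wt ls F i j) - wt (map ∣_∣ ls) F i j
        ≡⟨ cong (_- wt (map ∣_∣ ls) F i j) (trans (sym (wsum-abs _ ls F))
             (wt-unique U U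
               (All.map⁺ (All.universal 0≤∣l∣+l ls)) (All.map⁺ (All.universal 0≤∣p∣ ls))
               (λ k → trans (wsum-abs _ ls F)
                 (trans (cong (comb (map ∣_∣ ls) F k +_) (comb≡0 k)) (+-identityʳ _))) i j)) ⟩
      wt (map ∣_∣ ls) F i j - wt (map ∣_∣ ls) F i j
        ≡⟨ +-inverseʳ (wt (map ∣_∣ ls) F i j) ⟩
      0ℚ ∎
      where open ≡-Reasoning
    zeros : ∀ {ms G} → Pointwise (λ l a → wt ls F (tail a) (head a) ≡ l) ms G → All (_≡ 0ℚ) ms
    zeros []                     = []
    zeros {G = a ∷ _} (eq ∷ eqs) = trans (sym eq) (wt≡0 (tail a) (head a)) ∷ zeros eqs

  -- Both representations of `x` have the same matrix, so an arrow of `F` outside `G` carries weight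
  -- 0 and can be deleted without changing any weighted sum.
  common-face : ∀ {F G : List (Arrow n)} → Uncrossed τ F → Uncrossed τ G → Unique F →
    ∀ x → InConv (simplex F) x → InConv (simplex G) x →
    Σ (List (Arrow n)) λ H → All (λ a → a ∈ F × a ∈ G) H × InConv (simplex H) x
  common-face {F} {G} UF UG uniqueF x
    (ls , lenF , ls≥0 , sum≡1 , ls≡x) (ms , lenG , ms≥0 , _ , ms≡x)
    with restrict (Pointwise.map (λ {l} {a} → coeff-cases l a) (wt-coeff uniqueF lenF′))
           ls≥0 (All.tabulate id)
    where
    open DecMembership _≟ᴬ_ using (_∈?_)
    lenF′ : length ls ≡ length F
    lenF′ = trans lenF (length-map pt F)
    wt≡ : ∀ i j → wt ls F i j ≡ wt ms G i j
    wt≡ = wt-unique UF UG ls≥0 ms≥0 (λ k →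
      trans (sym (wsum-map (λ p → p k) pt ls F))
        (trans (ls≡x k) (trans (sym (ms≡x k)) (wsum-map (λ p → p k) pt ms G))))
    coeff-cases : ∀ l a → wt ls F (tail a) (head a) ≡ l → a ∈ G ⊎ l ≡ 0ℚ
    coeff-cases l a eq with a ∈? G
    ... | yes a∈G = inj₁ a∈G
    ... | no a∉G  = inj₂ (trans (sym eq) (trans (wt≡ (tail a) (head a)) (wt-∉ ms G a∉G)))
    restrict : ∀ {ks H} → Pointwise (λ l a → a ∈ G ⊎ l ≡ 0ℚ) ks H → All (0ℚ ≤_) ks → All (_∈ F) H →
      Σ (List (Arrow n)) λ H′ → Σ (List ℚ) λ ks′ → All (λ a → a ∈ F × a ∈ G) H′ ×
        length ks′ ≡ length H′ × All (0ℚ ≤_) ks′ × sumℚ ks′ ≡ sumℚ ks ×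
        ((f : Arrow n → ℚ) → wsum f ks′ H′ ≡ wsum f ks H)
    restrict [] _ _ = [] , [] , [] , refl , [] , refl , (λ _ → refl)
    restrict (inj₂ refl ∷ pw) (_ ∷ ks≥0) (_ ∷ ⊆F)
      with H′ , ks′ , sub , len , pos , sum , ws ← restrict pw ks≥0 ⊆F =
      H′ , ks′ , sub , len , pos , trans sum (sym (+-identityˡ _)) ,
      λ f → trans (ws f) (sym (trans (cong (_+ _) (*-zeroˡ (f _))) (+-identityˡ _)))
    restrict {l ∷ _} {a ∷ _} (inj₁ a∈G ∷ pw) (l≥0 ∷ ks≥0) (a∈F ∷ ⊆F)
      with H′ , ks′ , sub , len , pos , sum , ws ← restrict pw ks≥0 ⊆F =
      a ∷ H′ , l ∷ ks′ , (a∈F , a∈G) ∷ sub , cong suc len , l≥0 ∷ pos , cong (l +_) sum ,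
      λ f → cong (l * f a +_) (ws f)
  ... | H , ks , sub , len , ks≥0 , sum , ws =
    H , sub , ks , trans len (sym (length-map pt H)) , ks≥0 , trans sum sum≡1 ,
    λ k → trans (wsum-map (λ p → p k) pt ks H)
      (trans (ws _) (trans (sym (wsum-map (λ p → p k) pt ls F)) (ls≡x k)))

-- The priority order on tails

-- Both tails precede both heads, and the tail of smaller `τ` gets the nearer head. Increasing `τ`
-- yields crossing pairs, decreasing `τ` nesting pairs, so one condition covers both kinds of
-- complex.
Rule : ∀ {n} → (Fin (suc n) → ℕ) → (Arrow n → Arrow n → Set) → Set
Rule τ E = ∀ {i i′ j j′} → τ i <ℕ τ i′ → i <ᶠ j → i′ <ᶠ j → j <ᶠ j′ → E (i , j) (i′ , j′)

Increasing : ∀ {m n} → (Fin m → Fin n) → Set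
Increasing w = ∀ {p q} → p <ᶠ q → w p <ᶠ w q

increasing-reflects-< : ∀ {m n} {w : Fin m → Fin n} → Increasing w → ∀ p q → w p <ᶠ w q → p <ᶠ q
increasing-reflects-< inc p q lt with Fin.<-cmp p q
... | tri< p<q _ _  = p<q
... | tri≈ _ refl _ = contradiction lt (ℕ.<-irrefl refl)
... | tri> _ _ p>q  = contradiction lt (ℕ.<-asym (inc p>q))

increasing-injective : ∀ {m n} {w : Fin m → Fin n} → Increasing w → ∀ p q → w p ≡ w q → p ≡ q
increasing-injective inc p q eq with Fin.<-cmp p q
... | tri< p<q _ _ = contradiction (inc p<q) (ℕ.<-irrefl (cong toℕ eq))
... | tri≈ _ p≡q _ = p≡q
... | tri> _ _ p>q = contradiction (inc p>q) (ℕ.<-irrefl (cong toℕ (sym eq)))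

sameOrderType : ∀ {n m} {x y : Fin 4 → Fin (suc n)} {w w′ : Fin m → Fin (suc n)} (ρ : Fin 4 → Fin m) →
  (∀ p → x p ≡ w (ρ p)) → (∀ p → y p ≡ w′ (ρ p)) → Increasing w → Increasing w′ →
  SameOrderType x y
sameOrderType {w = w} {w′} ρ x≡ y≡ inc inc′ p q rewrite x≡ p | x≡ q | y≡ p | y≡ q =
  ((λ lt → inc′ (increasing-reflects-< inc (ρ p) (ρ q) lt)) ,
   (λ lt → inc (increasing-reflects-< inc′ (ρ p) (ρ q) lt))) ,
  ((λ eq → cong w′ (increasing-injective inc (ρ p) (ρ q) eq)) ,
   (λ eq → cong w (increasing-injective inc′ (ρ p) (ρ q) eq)))

-- `quad` lists tails before heads, so on a crossing pair it enumerates the endpoints in order. It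
-- thus also serves as the reference sequence for the nesting pair, which differs by a swap of the
-- last two slots.
quad-increasing : ∀ {n} {p₁ p₂ p₃ p₄ : Fin (suc n)} → p₁ <ᶠ p₂ → p₂ <ᶠ p₃ → p₃ <ᶠ p₄ →
  Increasing (quad (p₁ , p₃) (p₂ , p₄))
quad-increasing a b c {zero} {suc zero} _ = a
quad-increasing a b c {zero} {suc (suc zero)} _ = ℕ.<-trans a b
quad-increasing a b c {zero} {suc (suc (suc zero))} _ = ℕ.<-trans a (ℕ.<-trans b c)
quad-increasing a b c {suc zero} {suc (suc zero)} _ = b
quad-increasing a b c {suc zero} {suc (suc (suc zero))} _ = ℕ.<-trans b c
quad-increasing a b c {suc (suc zero)} {suc (suc (suc zero))} _ = c
quad-increasing a b c {suc zero} {suc zero} (s≤s ())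
quad-increasing a b c {suc (suc p)} {suc zero} (s≤s ())
quad-increasing a b c {suc (suc p)} {suc (suc zero)} (s≤s (s≤s ()))
quad-increasing a b c {suc (suc (suc p))} {suc (suc (suc zero))} (s≤s (s≤s (s≤s ())))

module _ {n : ℕ} {E : Arrow n → Arrow n → Set} (uniform : Uniform E)
         {p₁ p₂ p₃ p₄ : Fin (suc n)} (p₁<p₂ : p₁ <ᶠ p₂) (p₂<p₃ : p₂ <ᶠ p₃) (p₃<p₄ : p₃ <ᶠ p₄)
         {q₁ q₂ q₃ q₄ : Fin (suc n)} (q₁<q₂ : q₁ <ᶠ q₂) (q₂<q₃ : q₂ <ᶠ q₃) (q₃<q₄ : q₃ <ᶠ q₄) where

  crossing-transfer : E (p₁ , p₃) (p₂ , p₄) → E (q₁ , q₃) (q₂ , q₄)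
  crossing-transfer = uniform _ _ _ _
    (Fin.<⇒≢ (ℕ.<-trans p₁<p₂ p₂<p₃)) (Fin.<⇒≢ (ℕ.<-trans p₂<p₃ p₃<p₄))
    (Fin.<⇒≢ (ℕ.<-trans q₁<q₂ q₂<q₃)) (Fin.<⇒≢ (ℕ.<-trans q₂<q₃ q₃<q₄))
    (sameOrderType id (λ _ → refl) (λ _ → refl)
      (quad-increasing p₁<p₂ p₂<p₃ p₃<p₄) (quad-increasing q₁<q₂ q₂<q₃ q₃<q₄))

  nesting-transfer : E (p₁ , p₄) (p₂ , p₃) → E (q₁ , q₄) (q₂ , q₃)
  nesting-transfer = uniform _ _ _ _
    (Fin.<⇒≢ (ℕ.<-trans p₁<p₂ (ℕ.<-trans p₂<p₃ p₃<p₄))) (Fin.<⇒≢ p₂<p₃)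
    (Fin.<⇒≢ (ℕ.<-trans q₁<q₂ (ℕ.<-trans q₂<q₃ q₃<q₄))) (Fin.<⇒≢ q₂<q₃)
    (sameOrderType ρ relabel relabel
      (quad-increasing p₁<p₂ p₂<p₃ p₃<p₄) (quad-increasing q₁<q₂ q₂<q₃ q₃<q₄))
    where
    ρ : Fin 4 → Fin 4
    ρ zero                   = zero
    ρ (suc zero)             = suc zero
    ρ (suc (suc zero))       = suc (suc (suc zero))
    ρ (suc (suc (suc zero))) = suc (suc zero)
    relabel : ∀ {r₁ r₂ r₃ r₄ : Fin (suc n)} p →
      quad (r₁ , r₄) (r₂ , r₃) p ≡ quad (r₁ , r₃) (r₂ , r₄) (ρ p)
    relabel zero                   = refl
    relabel (suc zero)             = refl
    relabel (suc (suc zero))       = refl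
    relabel (suc (suc (suc zero))) = refl

-- For `n` below 3 there is no quadruple of vertices from which to read off the behaviour of type
-- `TTHH`; this bound makes `Rule` vacuous there.
four-increasing⇒3≤ : ∀ {a b c d} → a <ℕ b → b <ℕ c → c <ℕ d → 3 ≤ℕ d
four-increasing⇒3≤ p q r =
  ℕ.≤-trans (s≤s (ℕ.≤-trans (s≤s (ℕ.≤-trans (s≤s z≤n) p)) q)) r

-- A uniform complex either crosses all pairs of type TTHH, and then heads are matched with the
-- earliest available tail, or nests them all, and then heads are matched with the latest one.
priority : ∀ n {E : Arrow n → Arrow n → Set} → Symmetric E → Permissible E → Uniform E →
  Σ (Fin (suc n) → ℕ) λ τ → (∀ {i j} → τ i ≡ τ j → i ≡ j) × Rule τ E
priority zero _ _ _ = toℕ , Fin.toℕ-injective , λ {i} {i′} {j} {j′} a _ b c →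
  contradiction (ℕ.≤-trans (four-increasing⇒3≤ a b c) (Fin.toℕ≤pred[n] j′)) λ ()
priority (suc zero) _ _ _ = toℕ , Fin.toℕ-injective , λ {i} {i′} {j} {j′} a _ b c →
  contradiction (ℕ.≤-trans (four-increasing⇒3≤ a b c) (Fin.toℕ≤pred[n] j′)) λ { (s≤s ()) }
priority (suc (suc zero)) _ _ _ = toℕ , Fin.toℕ-injective , λ {i} {i′} {j} {j′} a _ b c →
  contradiction (ℕ.≤-trans (four-increasing⇒3≤ a b c) (Fin.toℕ≤pred[n] j′)) λ { (s≤s (s≤s ())) }
priority (suc (suc (suc m))) {E} symmetric (_ , _ , _ , exactlyOne) uniform
  with exactlyOne zero (suc zero) (suc (suc zero)) (suc (suc (suc zero)))
         (λ ()) (λ ()) (λ ()) (λ ()) (λ ()) (λ ())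
... | inj₁ (crossing , _) = toℕ , Fin.toℕ-injective , λ i<i′ _ i′<j j<j′ →
  crossing-transfer {E = E} uniform (s≤s z≤n) (s≤s (s≤s z≤n)) (s≤s (s≤s (s≤s z≤n)))
    i<i′ i′<j j<j′ crossing
... | inj₂ (_ , nesting) = (λ i → suc (suc (suc m)) ∸ toℕ i) ,
  (λ {i} {j} eq → Fin.toℕ-injective
    (ℕ.∸-cancelˡ-≡ (Fin.toℕ≤pred[n] i) (Fin.toℕ≤pred[n] j) eq)) ,
  λ {i} {i′} {j} {j′} τi<τi′ i<j _ j<j′ → symmetric _ _
    (nesting-transfer {E = E} uniform (s≤s z≤n) (s≤s (s≤s z≤n)) (s≤s (s≤s (s≤s z≤n)))
      (ℕ.≰⇒> λ i≤i′ → ℕ.<⇒≱ τi<τi′ (ℕ.∸-monoʳ-≤ (suc (suc (suc m))) i≤i′)) i<j j<j′ nesting)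

allPairs-lookup : {A : Set} {R : A → A → Set} {xs : List A} → (∀ a b → R a b → R b a) →
  AllPairs R xs → ∀ {a b} → a ∈ xs → b ∈ xs → a ≡ b ⊎ R a b
allPairs-lookup sym-R (_ ∷ _)    (here refl) (here refl) = inj₁ refl
allPairs-lookup sym-R (r ∷ _)    (here refl) (there b∈)  = inj₂ (All.lookup r b∈)
allPairs-lookup sym-R (r ∷ _)    (there a∈)  (here refl) = inj₂ (sym-R _ _ (All.lookup r a∈))
allPairs-lookup sym-R (_ ∷ rs)   (there a∈)  (there b∈)  = allPairs-lookup sym-R rs a∈ b∈

-- How an arrow emitted by the scan relates to every arrow emitted after it, stated without the
-- complex. The alternatives match the sources of edges: a shared head, a shared tail or type
-- `TTHH`, and disjoint intervals.
Later : ∀ {n} → (Fin (suc n) → ℕ) → Arrow n → Arrow n → Set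
Later τ a b = (head a ≡ head b × τ (tail a) <ℕ τ (tail b)) ⊎
  (head a <ᶠ head b × (τ (tail a) ≤ℕ τ (tail b) ⊎ head a <ᶠ tail b))

module _ {n : ℕ} {E : Arrow n → Arrow n → Set} {τ : Fin (suc n) → ℕ}
         (τ-injective : ∀ {i j} → τ i ≡ τ j → i ≡ j) (rule : Rule τ E)
         (symmetric : Symmetric E) (permissible : Permissible E) where

  exactly-one : ∀ {i₁ i₂ j₁ j₂} → i₁ ≢ i₂ → i₁ ≢ j₁ → i₁ ≢ j₂ → i₂ ≢ j₁ → i₂ ≢ j₂ → j₁ ≢ j₂ →
    ExactlyOne (E (i₁ , j₁) (i₂ , j₂)) (E (i₁ , j₂) (i₂ , j₁))
  exactly-one = proj₂ (proj₂ (proj₂ permissible)) _ _ _ _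

  τ<⇒≢ : ∀ {i j} → τ i <ℕ τ j → i ≢ j
  τ<⇒≢ lt refl = ℕ.<-irrefl refl lt

  -- A forbidden pair and the pair that `rule` makes an edge are the two matchings of the same tails
  -- with the same heads, and only one of them can be an edge.
  face-uncrossed : ∀ {F} → IsFace⁺ E F → Uncrossed τ F
  face-uncrossed {F} (face@(_ , _ , edges) , forward-F) = record
    { forward     = forward-F
    ; alternating = alternating-F (proj₁ permissible F face)
    ; uncrossed   = uncrossed-F
    }
    where
    alternating-F : Admissible F → ∀ {a b} → a ∈ F → b ∈ F → head a ≢ tail b
    alternating-F (I , J , disjoint , inIJ) {a} {b} a∈F b∈F head≡tail =
      disjoint (tail b) (proj₁ (All.lookup inIJ b∈F))
        (subst (_∈ₛ J) head≡tail (proj₂ (All.lookup inIJ a∈F)))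
    uncrossed-F : ∀ {i i′ j j′} → τ i <ℕ τ i′ → i <ᶠ j → j <ᶠ j′ →
      (i , j′) ∈ F → (i′ , j) ∈ F → ⊥
    uncrossed-F τ< i<j j<j′ ij′∈F i′j∈F
      with All.lookup forward-F i′j∈F | allPairs-lookup symmetric edges ij′∈F i′j∈F
    ... | _    | inj₁ refl = ℕ.<-irrefl refl j<j′
    ... | i′<j | inj₂ E-ij′-i′j
      with exactly-one (τ<⇒≢ τ<) (Fin.<⇒≢ i<j) (Fin.<⇒≢ (ℕ.<-trans i<j j<j′)) (Fin.<⇒≢ i′<j)
             (Fin.<⇒≢ (ℕ.<-trans i′<j j<j′)) (Fin.<⇒≢ j<j′)
    ...   | inj₁ (_ , ¬E) = ¬E E-ij′-i′j
    ...   | inj₂ (¬E , _) = ¬E (rule τ< i<j i′<j j<j′)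

  -- Priority order alone does not place `i′` before `j`. If `i′` lies beyond `j`, the competing
  -- matching is a nesting pair of type `THTH`, so `noNest` leaves only the disjoint one; otherwise
  -- `rule` or the shared tail decides.
  later⇒edge : THTHDoesNotNest E → ∀ {a b} → Forward a → Forward b → head a ≢ tail b →
    Later τ a b → E a b
  later⇒edge _ {i , j} {i′ , _} i<j i′<j _ (inj₁ (refl , τ<)) =
    proj₂ (proj₁ (proj₂ (proj₂ permissible)) j i i′
      (Fin.<⇒≢ i<j ∘ sym) (Fin.<⇒≢ i′<j ∘ sym) (τ<⇒≢ τ<))
  later⇒edge noNest {i , j} {i′ , j′} i<j i′<j′ _ (inj₂ (j<j′ , inj₂ j<i′))
    with exactly-one (Fin.<⇒≢ (ℕ.<-trans i<j j<i′)) (Fin.<⇒≢ i<j) (Fin.<⇒≢ (ℕ.<-trans i<j j<j′))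
           (Fin.<⇒≢ j<i′ ∘ sym) (Fin.<⇒≢ i′<j′) (Fin.<⇒≢ j<j′)
  ... | inj₁ (edge , _) = edge
  ... | inj₂ (_ , edge) = contradiction edge (noNest i j i′ j′ i<j j<i′ i′<j′)
  later⇒edge noNest {i , j} {i′ , j′} i<j i′<j′ j≢i′ (inj₂ (j<j′ , inj₁ τ≤))
    with Fin.<-cmp j i′ | ℕ.m≤n⇒m<n∨m≡n τ≤
  ... | tri< j<i′ _ _ | _       = later⇒edge noNest i<j i′<j′ j≢i′ (inj₂ (j<j′ , inj₂ j<i′))
  ... | tri≈ _ j≡i′ _ | _       = contradiction j≡i′ j≢i′
  ... | tri> _ _ i′<j | inj₁ τ< = rule τ< i<j i′<j j<j′
  ... | tri> _ _ i′<j | inj₂ eq with refl ← τ-injective eq =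
    proj₁ (proj₁ (proj₂ (proj₂ permissible)) i j j′
      (Fin.<⇒≢ i<j) (Fin.<⇒≢ i′<j′) (Fin.<⇒≢ j<j′))

-- The left-to-right scan

-- Tails already passed, each with the outflow it still has to send.
Pool : ℕ → Set
Pool n = List (Fin (suc n) × ℚ)

weigh : ∀ {n} → Vec (suc n) → Pool n → ℚ
weigh f []            = 0ℚ
weigh f ((i , m) ∷ p) = m * f i + weigh f p

load : ∀ {n} → Pool n → Vec (suc n)
load p v = weigh (λ i → e i v) p

mass : ∀ {n} → Pool n → ℚ
mass = weigh (λ _ → 1ℚ)

module Scan {n : ℕ} (τ : Fin (suc n) → ℕ) (τ-injective : ∀ {i j} → τ i ≡ τ j → i ≡ j)
            (x : Vec (suc n)) where

  Before : Fin (suc n) × ℚ → Fin (suc n) × ℚ → Set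
  Before (i , _) (j , _) = τ i <ℕ τ j

  record Valid (b : ℕ) (p : Pool n) : Set where
    constructor valid
    field
      sorted  : AllPairs Before p
      entries : All (λ (i , m) → 0ℚ < m × x i < 0ℚ × toℕ i <ℕ b) p

  insert : Fin (suc n) × ℚ → Pool n → Pool n
  insert q [] = q ∷ []
  insert q (r ∷ p) with τ (proj₁ q) ℕ.<? τ (proj₁ r)
  ... | yes _ = q ∷ r ∷ p
  ... | no _  = r ∷ insert q p

  weigh-insert : ∀ f j m p → weigh f (insert (j , m) p) ≡ m * f j + weigh f p
  weigh-insert f j m [] = refl
  weigh-insert f j m ((i , m′) ∷ p) with τ j ℕ.<? τ i
  ... | yes _ = refl
  ... | no _  = trans (cong (m′ * f i +_) (weigh-insert f j m p))
    (solve 3 (λ a b c → a :+ (b :+ c) := b :+ (a :+ c)) refl (m′ * f i) (m * f j) (weigh f p))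

  All-insert : ∀ {P : Fin (suc n) × ℚ → Set} {q p} → P q → All P p → All P (insert q p)
  All-insert Pq [] = Pq ∷ []
  All-insert {q = q} {r ∷ _} Pq (Pr ∷ Pp) with τ (proj₁ q) ℕ.<? τ (proj₁ r)
  ... | yes _ = Pq ∷ Pr ∷ Pp
  ... | no _  = Pr ∷ All-insert Pq Pp

  Any-insert : ∀ {P : Fin (suc n) × ℚ → Set} {q} p → Any P (insert q p) → P q ⊎ Any P p
  Any-insert [] (here Pq) = inj₁ Pq
  Any-insert {q = q} (r ∷ p) any with τ (proj₁ q) ℕ.<? τ (proj₁ r) | any
  ... | yes _ | here Pq   = inj₁ Pq
  ... | yes _ | there any′ = inj₂ any′
  ... | no _  | here Pr   = inj₂ (here Pr)
  ... | no _  | there any′ with Any-insert p any′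
  ...   | inj₁ Pq = inj₁ Pq
  ...   | inj₂ Pp = inj₂ (there Pp)

  sorted-insert : ∀ {q p} → All (λ r → proj₁ r ≢ proj₁ q) p → AllPairs Before p →
    AllPairs Before (insert q p)
  sorted-insert [] [] = [] ∷ []
  sorted-insert {q} {r ∷ _} (r≢q ∷ p≢q) (r<p ∷ p-sorted) with τ (proj₁ q) ℕ.<? τ (proj₁ r)
  ... | yes q<r = (q<r ∷ All.map (ℕ.<-trans q<r) r<p) ∷ r<p ∷ p-sorted
  ... | no q≮r  = All-insert (ℕ.≤∧≢⇒< (ℕ.≮⇒≥ q≮r) (r≢q ∘ τ-injective)) r<p
    ∷ sorted-insert p≢q p-sorted

  Available : Pool n → Fin (suc n) → Set
  Available p i = Any (λ r → proj₁ r ≡ i) p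

  -- With `b` the current position, a tail is either waiting in the pool or not yet scanned. `Later`
  -- is derived from this dichotomy: waiting tails are sorted by `τ`, unscanned ones lie beyond the
  -- current head.
  Placed : ℕ → Pool n → Arrow n → Set
  Placed b p a = Forward a × x (tail a) < 0ℚ × 0ℚ < x (head a) × b ≤ℕ toℕ (head a) ×
    (Available p (tail a) ⊎ b ≤ℕ toℕ (tail a))

  -- Weighted arrows that empty the pool p and meet the demand d, all with heads at or after b.
  record Plan (b : ℕ) (d : Vec (suc n)) (p : Pool n) : Set where
    constructor plan
    field
      weights : List ℚ
      arrows  : List (Arrow n)
      len     : length weights ≡ length arrows
      nonNeg  : All (0ℚ ≤_) weights
      meets   : ∀ v → comb weights arrows v ≡ d v - load p v
      placed  : All (Placed b p) arrows
      later   : AllPairs (Later τ) arrows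

  emit : ∀ {b b′ d d′ p p′} l i j → 0ℚ ≤ l → Placed b p (i , j) →
    (∀ v → d v - load p v ≡ l * pt (i , j) v + (d′ v - load p′ v)) →
    (∀ {a} → Placed b′ p′ a → Placed b p a × Later τ (i , j) a) →
    Plan b′ d′ p′ → Plan b d p
  emit l i j l≥0 placed-ij balance weaken (plan ls F len ls≥0 meets placed later) = plan
    (l ∷ ls) ((i , j) ∷ F) (cong suc len) (l≥0 ∷ ls≥0)
    (λ v → trans (cong (l * pt (i , j) v +_) (meets v)) (sym (balance v)))
    (placed-ij ∷ All.map (proj₁ ∘ weaken) placed) (All.map (proj₂ ∘ weaken) placed ∷ later)

  relax : ∀ {b b′ d d′ p p′} →
    (∀ v → d′ v - load p′ v ≡ d v - load p v) → (∀ {a} → Placed b′ p′ a → Placed b p a) →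
    Plan b′ d′ p′ → Plan b d p
  relax balance weaken (plan ls F len ls≥0 meets placed later) = plan
    ls F len ls≥0 (λ v → trans (meets v) (balance v)) (All.map weaken placed) later

  available-after : ∀ {r p i} → All (Before r) p → Available p i → τ (proj₁ r) <ℕ τ i
  available-after     (r<q ∷ _) (here refl) = r<q
  available-after {r} (_ ∷ r<p) (there av)  = available-after {r} r<p av

  -- The head j, still in need of s, consumes the pool from the front.
  serve : ∀ j → 0ℚ < x j → ∀ {d target s p} → 0ℚ ≤ s → Valid (toℕ j) p →
    mass p - s ≡ target → 0ℚ ≤ target →
    (∀ p′ → Valid (toℕ j) p′ → mass p′ ≡ target → Plan (suc (toℕ j)) d p′) →
    Plan (toℕ j) (λ v → s * e j v + d v) p
  serve j xj>0 {d} {target} {s} {[]} s≥0 v mass≡ target≥0 rest = relax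
    (λ w → cong (_- 0ℚ) (trans (sym (trans (cong (_+ d w) (*-zeroˡ (e j w))) (+-identityˡ (d w))))
      (cong (λ t → t * e j w + d w) (sym s≡0))))
    (λ { (f , neg , pos , b≤h , inj₂ b≤t) →
      f , neg , pos , ℕ.<⇒≤ b≤h , inj₂ (ℕ.<⇒≤ b≤t)
       ; (_ , _ , _ , _ , inj₁ ()) })
    -- With an empty pool `mass≡` reads `0ℚ - s ≡ target`, so both nonnegative numbers vanish: a
    -- nonnegative passing flow never leaves a head unserved.
    (rest [] v (≤-antisym target≥0
      (subst (_≤ 0ℚ) mass≡ (≤-trans (≤-reflexive (+-identityˡ (- s))) (neg-antimono-≤ s≥0)))))
    where
    s≡0 : s ≡ 0ℚ
    s≡0 = ≤-antisym
      (≤-trans (≤-reflexive (solve 1 (λ s → s := :- (con 0ℚ :- s)) refl s))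
        (neg-antimono-≤ (subst (0ℚ ≤_) (sym mass≡) target≥0)))
      s≥0
  serve j xj>0 {d} {target} {s} {(i , m) ∷ p} s≥0
    (valid (i<p ∷ p-sorted) ((m>0 , xi<0 , i<j) ∷ entries)) mass≡ target≥0 rest with s ℚ.<? m
  -- The front tail keeps the positive mass `m - s`. A tie goes to the other branch, which drops the
  -- entry; the head, now needing 0, then emits an arrow of weight 0 from the next tail if there is
  -- one.
  ... | yes s<m = emit s i j s≥0
    (i<j , xi<0 , xj>0 , ℕ.≤-refl , inj₁ (here refl))
    (λ v → solve 6 (λ s ej ei m d l →
        (s :* ej :+ d) :- (m :* ei :+ l) := s :* (ej :- ei) :+ (d :- ((m :- s) :* ei :+ l))) refl
      s (e j v) (e i v) m (d v) (load p v))
    (λ { (f , neg , pos , j<h , inj₁ (here refl)) →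
           (f , neg , pos , ℕ.<⇒≤ j<h , inj₁ (here refl)) , inj₂ (j<h , inj₁ ℕ.≤-refl)
       ; (f , neg , pos , j<h , inj₁ (there av)) →
           (f , neg , pos , ℕ.<⇒≤ j<h , inj₁ (there av)) ,
           inj₂ (j<h , inj₁ (ℕ.<⇒≤ (available-after {i , m} i<p av)))
       ; (f , neg , pos , j<h , inj₂ j<t) →
           (f , neg , pos , ℕ.<⇒≤ j<h , inj₂ (ℕ.<⇒≤ j<t)) , inj₂ (j<h , inj₂ j<t) })
    (rest ((i , m - s) ∷ p)
      (valid (i<p ∷ p-sorted)
        ((≤-<-trans (≤-reflexive (sym (+-inverseʳ s))) (+-monoˡ-< (- s) s<m) , xi<0 , i<j) ∷ entries))
      (trans (solve 3 (λ m s t → (m :- s) :* con 1ℚ :+ t := (m :* con 1ℚ :+ t) :- s) refl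
        m s (mass p)) mass≡))
  ... | no s≮m = emit m i j (<⇒≤ m>0)
    (i<j , xi<0 , xj>0 , ℕ.≤-refl , inj₁ (here refl))
    (λ v → solve 6 (λ s ej ei m d l →
        (s :* ej :+ d) :- (m :* ei :+ l) := m :* (ej :- ei) :+ (((s :- m) :* ej :+ d) :- l)) refl
      s (e j v) (e i v) m (d v) (load p v))
    (λ { {t , h} (f , neg , pos , j≤h , inj₁ av) →
           (f , neg , pos , j≤h , inj₁ (there av)) , split j≤h (available-after {i , m} i<p av)
       ; {t , h} (f , neg , pos , j≤h , inj₂ j≤t) →
           (f , neg , pos , j≤h , inj₂ j≤t) ,
           -- The tail `t` is not `j`, since `x` is positive at `j` and negative at `t`; so it lies
           -- strictly beyond `j`.
           inj₂ (ℕ.≤-<-trans j≤t f , inj₂ (ℕ.≤∧≢⇒< j≤t λ eq →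
             <-asym xj>0 (subst (λ k → x k < 0ℚ) (sym (Fin.toℕ-injective eq)) neg))) })
    (serve j xj>0 {d} {target} {s - m} {p}
      (≤-trans (≤-reflexive (sym (+-inverseʳ m))) (+-monoˡ-≤ (- m) (≮⇒≥ s≮m)))
      (valid p-sorted entries)
      (trans (solve 3 (λ m s t → t :- (s :- m) := (m :* con 1ℚ :+ t) :- s) refl
        m s (mass p)) mass≡)
      target≥0 rest)
    where
    split : ∀ {h t} → toℕ j ≤ℕ toℕ h → τ i <ℕ τ t → Later τ (i , j) (t , h)
    split j≤h τ< with ℕ.m≤n⇒m<n∨m≡n j≤h
    ... | inj₁ j<h = inj₂ (j<h , inj₁ (ℕ.<⇒≤ τ<))
    ... | inj₂ j≡h = inj₁ (Fin.toℕ-injective j≡h , τ<)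

  demand : ∀ {m} → (Fin m → Fin (suc n)) → Vec (suc n)
  demand ι v = total (λ k → x (ι k) * e (ι k) v)

  empty-pool : ∀ {b p} → Valid b p → mass p ≡ 0ℚ → p ≡ []
  empty-pool {p = []} _ _ = refl
  empty-pool {p = (i , m) ∷ p} (valid _ ((m>0 , _) ∷ entries)) mass≡0 =
    contradiction (+-mono-<-≤ (<-≤-trans m>0 (≤-reflexive (sym (*-identityʳ m)))) (mass≥0 entries))
      (<-irrefl (sym mass≡0))
    where
    mass≥0 : ∀ {b q} → All (λ (i , m) → 0ℚ < m × x i < 0ℚ × toℕ i <ℕ b) q → 0ℚ ≤ mass q
    mass≥0 [] = ≤-refl
    mass≥0 {q = (_ , m′) ∷ _} ((m′>0 , _) ∷ es) =
      +-mono-≤ (≤-trans (<⇒≤ m′>0) (≤-reflexive (sym (*-identityʳ m′)))) (mass≥0 es)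

  -- `ι` enumerates the vertices still ahead, and `Q k` is the flow over the gap just before the
  -- `k`-th of them. Matching the pool's mass with `Q` lets `Q≥0` guarantee that every head is
  -- served and `Q-last` that the final pool is empty.
  scan : ∀ {m} (ι : Fin m → Fin (suc n)) → Increasing ι → (Q : Fin (suc m) → ℚ) → (∀ k → 0ℚ ≤ Q k) →
    Q (fromℕ m) ≡ 0ℚ → (∀ k → Q (suc k) ≡ Q (inject₁ k) - x (ι k)) →
    ∀ {b p} → Valid b p → mass p ≡ Q zero → (∀ k → b ≤ℕ toℕ (ι k)) → Plan b (demand ι) p
  scan {zero} ι _ Q _ Q-last _ {b} {p} v mass≡ _ with refl ← empty-pool {b} {p} v (trans mass≡ Q-last) =
    plan [] [] refl [] (λ _ → refl) [] []
  scan {suc m} ι ι-inc Q Q≥0 Q-last Q-step {b} {p} v@(valid p-sorted entries) mass≡ b≤ = go (ℚ.<-cmp (x j) 0ℚ)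
    where
    j : Fin (suc n)
    j = ι zero

    rest : ∀ {p′} → Valid (suc (toℕ j)) p′ → mass p′ ≡ Q (suc zero) →
      Plan (suc (toℕ j)) (demand (ι ∘ suc)) p′
    rest v′ mass′≡ = scan (ι ∘ suc) (λ lt → ι-inc (s≤s lt)) (Q ∘ suc) (Q≥0 ∘ suc) Q-last
      (Q-step ∘ suc) v′ mass′≡ (λ k → ι-inc {zero} {suc k} (s≤s z≤n))

    extend : ∀ {p′ c} → c ≤ℕ suc (toℕ j) → Valid c p′ → Valid (suc (toℕ j)) p′
    extend c≤ (valid s es) =
      valid s (All.map (λ (m>0 , neg , lt) → m>0 , neg , ℕ.<-≤-trans lt c≤) es)

    demand-suc : ∀ w → demand ι w ≡ x j * e j w + demand (ι ∘ suc) w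
    demand-suc w = sum-suc (λ k → x (ι k) * e (ι k) w)

    later-start : ∀ {p′ a} → (Available p′ (tail a) → Available p (tail a) ⊎ j ≡ tail a) →
      Placed (suc (toℕ j)) p′ a → Placed b p a
    later-start from (f , neg , pos , j<h , inj₂ j<t) =
      f , neg , pos , ℕ.≤-trans (b≤ zero) (ℕ.<⇒≤ j<h) , inj₂ (ℕ.≤-trans (b≤ zero) (ℕ.<⇒≤ j<t))
    later-start from (f , neg , pos , j<h , inj₁ av) with from av
    ... | inj₁ av′  = f , neg , pos , ℕ.≤-trans (b≤ zero) (ℕ.<⇒≤ j<h) , inj₁ av′
    -- The tail `j` has just entered the pool; seen from `b` it still counts as unscanned.
    ... | inj₂ refl = f , neg , pos , ℕ.≤-trans (b≤ zero) (ℕ.<⇒≤ j<h) , inj₂ (b≤ zero)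

    go : _ → Plan b (demand ι) p
    go (tri≈ _ xj≡0 _) = relax
      (λ w → cong (_- load p w) (sym (trans (demand-suc w)
        (trans (cong (λ t → t * e j w + demand (ι ∘ suc) w) xj≡0)
          (trans (cong (_+ demand (ι ∘ suc) w) (*-zeroˡ (e j w))) (+-identityˡ (demand (ι ∘ suc) w)))))))
      (λ {a} → later-start {p} {a} inj₁)
      (rest (extend (ℕ.m≤n⇒m≤1+n (b≤ zero)) v) (trans mass≡ (sym (trans (Q-step zero)
        (trans (cong (λ t → Q zero - t) xj≡0) (+-identityʳ (Q zero)))))))
    go (tri< xj<0 _ _) = relax
      (λ w → trans (cong (λ t → demand (ι ∘ suc) w - t) (weigh-insert (λ i → e i w) j (- x j) p))
        (trans (solve 4 (λ d xj ej l → d :- (:- xj :* ej :+ l) := (xj :* ej :+ d) :- l) refl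
          (demand (ι ∘ suc) w) (x j) (e j w) (load p w))
          (cong (_- load p w) (sym (demand-suc w)))))
      (λ {a} → later-start {insert (j , - x j) p} {a} λ av → swap (Any-insert p av))
      (rest
        (valid
          (sorted-insert (All.map (λ (_ , _ , lt) eq →
            ℕ.<-irrefl (cong toℕ eq) (ℕ.<-≤-trans lt (b≤ zero))) entries) p-sorted)
          (All-insert (neg-antimono-< xj<0 , xj<0 , ℕ.≤-refl)
            (Valid.entries (extend (ℕ.m≤n⇒m≤1+n (b≤ zero)) v))))
        (trans (weigh-insert (λ _ → 1ℚ) j (- x j) p)
          (trans (solve 2 (λ xj t → :- xj :* con 1ℚ :+ t := t :- xj) refl (x j) (mass p))
            (trans (cong (_- x j) mass≡) (sym (Q-step zero))))))
    go (tri> _ _ xj>0) = relax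
      (λ w → cong (_- load p w) (sym (demand-suc w)))
      (λ { (f , neg , pos , j≤h , inj₁ av) → f , neg , pos , ℕ.≤-trans (b≤ zero) j≤h , inj₁ av
         ; (f , neg , pos , j≤h , inj₂ j≤t) →
             f , neg , pos , ℕ.≤-trans (b≤ zero) j≤h , inj₂ (ℕ.≤-trans (b≤ zero) j≤t) })
      (serve j xj>0 (<⇒≤ xj>0)
        (valid p-sorted (All.map (λ (m>0 , neg , lt) → m>0 , neg , ℕ.<-≤-trans lt (b≤ zero)) entries))
        (trans (cong (_- x j) mass≡) (sym (Q-step zero))) (Q≥0 (suc zero))
        (λ p′ v′ mass′≡ → rest (extend (ℕ.n≤1+n (toℕ j)) v′) mass′≡))

-- Dimension and facets

module Elimination {m : ℕ} (v : Vec (suc m)) (p : Fin (suc m)) (vp≢0 : v p ≢ 0ℚ) where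

  instance
    vp-nonZero : NonZero (v p)
    vp-nonZero = ≢-nonZero vp≢0

  ratio : Vec (suc m) → ℚ
  ratio w = w p * 1/ (v p)

  eliminate : Vec (suc m) → Vec (suc m)
  eliminate w k = w k - v k * ratio w

  eliminate-p : ∀ w → eliminate w p ≡ 0ℚ
  eliminate-p w = trans
    (solve 3 (λ w v i → w :- v :* (w :* i) := w :- w :* (v :* i)) refl (w p) (v p) (1/ (v p)))
    (trans (cong (λ t → w p - w p * t) (*-inverseʳ (v p)))
      (trans (cong (λ t → w p - t) (*-identityʳ (w p))) (+-inverseʳ (w p))))

  combination≡0 : ∀ vs ls → lincomb ls (map (λ w → eliminate w ∘ punchIn p) vs) ≋ zeroV →
    lincomb (- wsum ratio ls vs ∷ ls) (v ∷ vs) ≋ zeroV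
  combination≡0 vs ls eliminated≡0 k = trans
    (solve 3 (λ s v t → :- s :* v :+ t := t :- v :* s) refl (wsum ratio ls vs) (v k) (lincomb ls vs k))
    (trans (cong (λ t → lincomb ls vs k - t) (sym (wsum-* (v k) ratio ls vs)))
      (trans (sym (wsum-- (λ w → w k) (λ w → v k * ratio w) ls vs)) (coordinate (p ≟ k))))
    where
    coordinate : Dec (p ≡ k) → wsum (λ w → eliminate w k) ls vs ≡ 0ℚ
    coordinate (yes refl) = trans (wsum-cong′ ls vs eliminate-p) (wsum-0 ls vs)
    coordinate (no p≢k) = subst (λ k → wsum (λ w → eliminate w k) ls vs ≡ 0ℚ)
      (Fin.punchIn-punchOut p≢k)
      (trans (sym (wsum-map (λ w → w (punchOut p≢k)) (λ w → eliminate w ∘ punchIn p) ls vs))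
        (eliminated≡0 (punchOut p≢k)))

-- Gaussian elimination: a nonzero coordinate of `v` is cleared from the other vectors and dropped,
-- and a relation among the results pulls back with a suitable weight on `v`. If `v` vanishes,
-- weight 1 on `v` alone is a relation.
dependent : ∀ {m} (vs : List (Vec m)) → m <ℕ length vs →
  Σ (List ℚ) λ ls → length ls ≡ length vs × lincomb ls vs ≋ zeroV × ¬ All (_≡ 0ℚ) ls
dependent {m} (v ∷ vs) m<len with Fin.any? (λ k → ¬? (v k ℚ.≟ 0ℚ))
... | no v≡0 = 1ℚ ∷ map (λ _ → 0ℚ) vs , cong suc (length-map _ vs) ,
  (λ k → cong₂ _+_ (trans (*-identityˡ (v k)) (decidable-stable (v k ℚ.≟ 0ℚ) (λ vk≢0 → v≡0 (k , vk≢0))))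
    (zero-weights vs k)) ,
  λ { (1≡0 ∷ _) → 1≢0 1≡0 }
  where
  zero-weights : ∀ ws k → lincomb (map (λ _ → 0ℚ) ws) ws k ≡ 0ℚ
  zero-weights []       k = refl
  zero-weights (w ∷ ws) k = cong₂ _+_ (*-zeroˡ (w k)) (zero-weights ws k)
dependent {suc m} (v ∷ vs) (s≤s m<len) | yes (p , vp≢0)
  with ls , len , eliminated≡0 , nontrivial ←
         dependent {m} (map (λ w → Elimination.eliminate v p vp≢0 w ∘ punchIn p) vs)
         (subst (m <ℕ_) (sym (length-map _ vs)) m<len)
  = - wsum ratio ls vs ∷ ls , cong suc (trans len (length-map _ vs)) , combination≡0 vs ls eliminated≡0 ,
    λ { (_ ∷ all≡0) → nontrivial all≡0 }
  where open Elimination v p vp≢0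

gen-balanced : ∀ {n} {v : Vec (suc n)} → IsGenP⁺ v → dot (λ _ → 1ℚ) v ≡ 0ℚ
gen-balanced {n} {v} (inj₁ v≋0) =
  trans (dot-cong (λ _ → 1ℚ) {v} v≋0) (dot-zeroV {suc n} (λ _ → 1ℚ))
gen-balanced {v = v} (inj₂ (a , _ , v≋a)) =
  trans (dot-cong (λ _ → 1ℚ) {v} v≋a) (trans (dot-pt (λ _ → 1ℚ) a) (+-inverseʳ 1ℚ))

lincomb-zero : ∀ {n} (ls : List ℚ) {ps : List (Vec (suc n))} → All IsGenP⁺ ps →
  (∀ k → lincomb ls ps (suc k) ≡ 0ℚ) → lincomb ls ps ≋ zeroV
lincomb-zero ls gens rest≡0 (suc k) = rest≡0 k
lincomb-zero {n} ls {ps} gens rest≡0 zero = begin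
  s zero                                              ≡⟨ +-identityʳ (s zero) ⟨
  s zero + 0ℚ                                         ≡⟨ cong₂ _+_ (*-identityˡ (s zero)) others≡0 ⟨
  1ℚ * s zero + sumℚ (map (λ k → 1ℚ * s (suc k)) (allFin n)) ≡⟨ sum-suc (λ k → 1ℚ * s k) ⟨
  dot (λ _ → 1ℚ) s                                    ≡⟨ dot-wsum (λ _ → 1ℚ) (λ k p → p k) ls ps ⟩
  wsum (dot (λ _ → 1ℚ)) ls ps                         ≡⟨ wsum-cong ls (All.map gen-balanced gens) ⟩
  wsum (λ _ → 0ℚ) ls ps                               ≡⟨ wsum-0 ls ps ⟩
  0ℚ                                                  ∎
  where
  open ≡-Reasoning
  s : Vec (suc n)
  s = lincomb ls ps
  others≡0 : sumℚ (map (λ k → 1ℚ * s (suc k)) (allFin n)) ≡ 0ℚ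
  others≡0 = trans (sum-cong (allFin n) (λ k → trans (*-identityˡ (s (suc k))) (rest≡0 k)))
    (sum-0 (allFin n))

-- The coordinate sum of a generator vanishes, so the first coordinate carries no information
-- and can be traded for the constant 1.
lift : ∀ {n} → Vec (suc n) → Vec (suc n)
lift v zero    = 1ℚ
lift v (suc k) = v (suc k)

gens-dependent : ∀ {n} (ps : List (Vec (suc n))) → All IsGenP⁺ ps → length ps ≡ suc (suc n) →
  ¬ AffinelyIndependent ps
gens-dependent {n} ps gens len independent
  with ls , lenls , lifted≡0 , nontrivial ← dependent (map lift ps)
         (ℕ.≤-reflexive (trans (sym len) (sym (length-map lift ps))))
  = nontrivial (independent ls lenls′ (sum≡0 ls lenls′ lifted≡0)
      (lincomb-zero ls gens (λ k → trans (sym (wsum-map (λ p → p (suc k)) lift ls ps)) (lifted≡0 (suc k)))))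
  where
  lenls′ : length ls ≡ length ps
  lenls′ = trans lenls (length-map lift ps)
  sum≡0 : ∀ ls → length ls ≡ length ps → lincomb ls (map lift ps) ≋ zeroV → sumℚ ls ≡ 0ℚ
  sum≡0 ls len lifted≡0 = trans (sym (trans (wsum-const 1ℚ ls ps len) (*-identityʳ (sumℚ ls))))
    (trans (sym (wsum-map (λ p → p zero) lift ls ps)) (lifted≡0 zero))

-- A functional equal to 1 on all points used makes the total weight depend on the represented
-- vector alone. This turns linear relations on a facet into affine ones, keeps the origin off it,
-- and recovers total weight 1 after the scan.
height-sum : ∀ {m} {A : Set} (c : Vec m) (f : A → Vec m) {ls : List ℚ} {as : List A} {x : Vec m} →
  length ls ≡ length as → All (λ a → dot c (f a) ≡ 1ℚ) as →
  (∀ k → wsum (λ a → f a k) ls as ≡ x k) → sumℚ ls ≡ dot c x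
height-sum c f {ls} {as} {x} len heights eq = begin
  sumℚ ls                            ≡⟨ *-identityʳ (sumℚ ls) ⟨
  sumℚ ls * 1ℚ                       ≡⟨ wsum-const 1ℚ ls as len ⟨
  wsum (λ _ → 1ℚ) ls as              ≡⟨ wsum-cong ls heights ⟨
  wsum (λ a → dot c (f a)) ls as     ≡⟨ dot-wsum c (λ k a → f a k) ls as ⟨
  dot c (λ k → wsum (λ a → f a k) ls as) ≡⟨ dot-cong c eq ⟩
  dot c x                            ∎
  where open ≡-Reasoning

face-dependent : ∀ {n} (c : Vec (suc n)) (ps : List (Vec (suc n))) → All (FaceGen c 1ℚ) ps →
  length ps ≡ suc n → ¬ AffinelyIndependent ps
face-dependent {n} c ps gens len independent
  with ls , lenls , restricted≡0 , nontrivial ← dependent (map (_∘ suc) ps)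
         (ℕ.≤-reflexive (trans (sym len) (sym (length-map (_∘ suc) ps))))
  = nontrivial (independent ls (trans lenls (length-map (_∘ suc) ps))
      (trans (height-sum c id {ls} {ps} (trans lenls (length-map (_∘ suc) ps)) (All.map proj₂ gens)
        (comb≡0 ls restricted≡0)) (dot-zeroV c))
      (comb≡0 ls restricted≡0))
  where
  comb≡0 : ∀ ls → lincomb ls (map (_∘ suc) ps) ≋ zeroV → lincomb ls ps ≋ zeroV
  comb≡0 ls restricted≡0 = lincomb-zero ls (All.map proj₁ gens)
    (λ k → trans (sym (wsum-map (λ p → p k) (_∘ suc) ls ps)) (restricted≡0 k))

simplex-independent : ∀ {n} {τ : Fin (suc n) → ℕ} → (∀ {i j} → τ i ≡ τ j → i ≡ j) →
  ∀ {F : List (Arrow n)} → Uncrossed τ F → Unique F →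
  ∀ ls → length ls ≡ length (simplex F) → lincomb ls (simplex F) ≋ zeroV → All (_≡ 0ℚ) ls
simplex-independent τ-injective {F} U uniqueF ls len eq = uncrossed-independent τ-injective U uniqueF ls
  (trans len (length-map pt F)) (λ k → trans (sym (wsum-map (λ p → p k) pt ls F)) (eq k))

indicator : Bool → ℚ
indicator b = if b then 1ℚ else 0ℚ

indicator-difference≤1 : ∀ b b′ → indicator b - indicator b′ ≤ 1ℚ
indicator-difference≤1 true  true  = 0≤1
indicator-difference≤1 true  false = ≤-refl
indicator-difference≤1 false true  = ≤-trans (neg-antimono-≤ 0≤1) 0≤1
indicator-difference≤1 false false = 0≤1

-- The facets avoiding the origin correspond to the partitions of the vertices into tails and
-- heads for which 0 is a tail and the last vertex is a head.
module Facet {d : ℕ} (χ : Fin (suc (suc d)) → Bool)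
             (χ-zero : χ zero ≡ false) (χ-last : χ (fromℕ (suc d)) ≡ true) where

  c : Vec (suc (suc d))
  c = indicator ∘ χ

  Respects : Arrow (suc d) → Set
  Respects a = χ (tail a) ≡ false × χ (head a) ≡ true

  dot-respects : ∀ {a} → Respects a → dot c (pt a) ≡ 1ℚ
  dot-respects {a} (t , h) = trans (dot-pt c a) (cong₂ (λ p q → indicator p - indicator q) h t)

  valid-ineq : ValidIneq c 1ℚ
  valid-ineq v (inj₁ v≋0) =
    ≤-trans (≤-reflexive (trans (dot-cong c {v} v≋0) (dot-zeroV c))) 0≤1
  valid-ineq v (inj₂ (a , _ , v≋a)) = ≤-trans (≤-reflexive (trans (dot-cong c {v} v≋a) (dot-pt c a)))
    (indicator-difference≤1 (χ (head a)) (χ (tail a)))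

  -- Builds a spanning tree on the facet: each head hangs from vertex 0 and each other tail points
  -- to the last vertex. Its `suc d` arrows witness the dimension of the facet and, together with
  -- the origin, that of the polytope.
  branch : Bool → Fin (suc d) → Arrow (suc d)
  branch true  t = zero , suc t
  branch false t = suc t , fromℕ (suc d)

  tree : List (Arrow (suc d))
  tree = tabulate (λ t → branch (χ (suc t)) t)

  tree-property : (P : Arrow (suc d) → Set) → (∀ t → χ (suc t) ≡ true → P (zero , suc t)) →
    (∀ t → χ (suc t) ≡ false → P (suc t , fromℕ (suc d))) → All P tree
  tree-property P from-zero to-last = All.tabulate⁺ choose
    where
    choose : ∀ t → P (branch (χ (suc t)) t)
    choose t with χ (suc t) in eq
    ... | true  = from-zero t eq
    ... | false = to-last t eq

  tree-forward : All Forward tree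
  tree-forward = tree-property Forward (λ t _ → s≤s z≤n) λ t χ≡false →
    Fin.≤∧≢⇒< (Fin.≤fromℕ (suc t)) λ { refl → contradiction (trans (sym χ-last) χ≡false) λ () }

  tree-respects : All Respects tree
  tree-respects = tree-property Respects (λ t χ≡true → χ-zero , χ≡true) (λ t χ≡false → χ≡false , χ-last)

  tree-unique : Unique tree
  tree-unique = Unique.tabulate⁺ λ {s} {t} → branch-injective (χ (suc s)) (χ (suc t))
    where
    branch-injective : ∀ b b′ {s t} → branch b s ≡ branch b′ t → s ≡ t
    branch-injective true  true  refl = refl
    branch-injective false false refl = refl

  -- A forbidden pair has `i′` above some vertex and `j` below some vertex, but an arrow `(i′ , j)`
  -- of the tree starts at 0 or ends at the last vertex. The order `toℕ` works here whichever order
  -- suits the complex.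
  tree-uncrossed : Uncrossed toℕ tree
  tree-uncrossed = record
    { forward     = tree-forward
    ; alternating = λ {a} {b} a∈ b∈ eq → contradiction
        (trans (sym (proj₂ (All.lookup tree-respects a∈)))
          (trans (cong χ eq) (proj₁ (All.lookup tree-respects b∈)))) λ ()
    ; uncrossed   = λ i<i′ _ j<j′ _ i′j∈ → star i<i′ j<j′ (All.lookup
        (tree-property (λ a → tail a ≡ zero ⊎ head a ≡ fromℕ (suc d)) (λ _ _ → inj₁ refl) (λ _ _ → inj₂ refl))
        i′j∈)
    }
    where
    star : ∀ {i i′ j j′ : Fin (suc (suc d))} → i <ᶠ i′ → j <ᶠ j′ → i′ ≡ zero ⊎ j ≡ fromℕ (suc d) → ⊥
    star () _ (inj₁ refl)
    star _ j<j′ (inj₂ refl) = ℕ.<⇒≱ j<j′ (Fin.≤fromℕ _)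

  tree-simplex-independent : ∀ ls → length ls ≡ length (simplex tree) →
    lincomb ls (simplex tree) ≋ zeroV → All (_≡ 0ℚ) ls
  tree-simplex-independent = simplex-independent Fin.toℕ-injective tree-uncrossed tree-unique

  length-tree : length (simplex tree) ≡ suc d
  length-tree = trans (length-map pt tree) (length-tabulate (λ t → branch (χ (suc t)) t))

  face-gens : ∀ {F} → All Forward F → All Respects F → All (FaceGen c 1ℚ) (simplex F)
  face-gens forward-F respects = All.map⁺ (All.zipWith
    (λ (f , r) → inj₂ (_ , f , λ _ → refl) , dot-respects r) (forward-F , respects))

  dim-P⁺ : AffDim (IsGenP⁺ {suc d}) (suc d)
  dim-P⁺ = (zeroV ∷ simplex tree ,
      inj₁ (λ _ → refl) ∷ All.map proj₁ (face-gens tree-forward tree-respects) ,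
      cong suc length-tree , independent) ,
    gens-dependent
    where
    independent : AffinelyIndependent (zeroV ∷ simplex tree)
    independent (l ∷ ls) len sum≡0 comb≡0 = l≡0 ∷ ls≡0
      where
      ls≡0 : All (_≡ 0ℚ) ls
      ls≡0 = tree-simplex-independent ls (ℕ.suc-injective len)
        (λ k → trans (sym (trans (cong (_+ lincomb ls (simplex tree) k) (*-zeroʳ l)) (+-identityˡ _)))
          (comb≡0 k))
      sum-zeros : ∀ {ms} → All (_≡ 0ℚ) ms → sumℚ ms ≡ 0ℚ
      sum-zeros []            = refl
      sum-zeros (refl ∷ ms≡0) = trans (+-identityˡ _) (sum-zeros ms≡0)
      l≡0 : l ≡ 0ℚ
      l≡0 = trans (sym (trans (cong (l +_) (sum-zeros ls≡0)) (+-identityʳ l))) sum≡0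

  dim-face : AffDim (FaceGen c 1ℚ) d
  dim-face = (simplex tree , face-gens tree-forward tree-respects , length-tree ,
      λ ls len _ comb≡0 → tree-simplex-independent ls len comb≡0) ,
    face-dependent c

  in-outer-boundary : ∀ {F x} → All Forward F → All Respects F → InConv (simplex F) x → InOuterBoundary x
  in-outer-boundary {F} forward-F respects conv =
    c , 1ℚ , (valid-ineq , d , dim-P⁺ , dim-face) , origin-outside ,
    simplex F , face-gens forward-F respects , conv
    where
    origin-outside : ¬ InFace c 1ℚ zeroV
    origin-outside (ps , gens , ls , len , _ , sum≡1 , comb≡0) = 1≢0
      (trans (sym sum≡1) (trans (height-sum c id {ls} {ps} len (All.map proj₂ gens) comb≡0) (dot-zeroV c)))

-- Declaring the heads of `F` and the last vertex to be heads, and all others tails, selects a facet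
-- containing `F`: by alternation and forwardness no tail of `F` is declared a head, and 0 is never
-- one. With a single vertex there are no forward arrows, so no point to treat.
uncrossed-in-outer-boundary : ∀ {n} {τ : Fin (suc n) → ℕ} {F : List (Arrow n)} → Uncrossed τ F →
  ∀ x → InConv (simplex F) x → InOuterBoundary x
uncrossed-in-outer-boundary {zero} {F = []} U x ([] , _ , _ , () , _)
uncrossed-in-outer-boundary {zero} {F = (zero , zero) ∷ _} U x _ with Uncrossed.forward U
... | () ∷ _
uncrossed-in-outer-boundary {suc d} {F = F} U x conv =
  Facet.in-outer-boundary χ χ-zero χ-last (forward U) respects conv
  where
  IsHead : Fin (suc (suc d)) → Set
  IsHead k = k ≡ fromℕ (suc d) ⊎ Any (λ a → k ≡ head a) F
  isHead? : ∀ k → Dec (IsHead k)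
  isHead? k = (k ≟ fromℕ (suc d)) ⊎-dec any? (λ a → k ≟ head a) F
  χ : Fin (suc (suc d)) → Bool
  χ k = does (isHead? k)
  χ-last : χ (fromℕ (suc d)) ≡ true
  χ-last = dec-true (isHead? _) (inj₁ refl)
  χ-zero : χ zero ≡ false
  χ-zero = dec-false (isHead? zero) λ { (inj₂ zero∈) → not-head zero∈ }
    where
    not-head : ¬ Any (λ a → zero ≡ head a) F
    not-head some with find some
    ... | (_ , zero) , a∈F , refl with () ← All.lookup (forward U) a∈F
  respects : All (Facet.Respects χ χ-zero χ-last) F
  respects = All.tabulate λ {a} a∈F →
    dec-false (isHead? (tail a)) (tail-not-head a∈F) ,
    dec-true (isHead? (head a)) (inj₂ (lose a∈F refl))
    where
    tail-not-head : ∀ {a} → a ∈ F → ¬ IsHead (tail a)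
    tail-not-head a∈F (inj₁ refl) = ℕ.<⇒≱ (All.lookup (forward U) a∈F) (Fin.≤fromℕ _)
    tail-not-head a∈F (inj₂ some) with find some
    ... | b , b∈F , eq = alternating U b∈F a∈F (sym eq)

-- Covering the outer boundary

-- Taken at the tail minus at the head, this is 1 exactly when a forward arrow passes over the gap
-- just before `k`.
ind : ℕ → ℕ → ℚ
ind i k = if does (i ℕ.<? k) then 1ℚ else 0ℚ

ind-< : ∀ {i k} → i <ℕ k → ind i k ≡ 1ℚ
ind-< {i} {k} i<k rewrite dec-true (i ℕ.<? k) i<k = refl

ind-≥ : ∀ {i k} → k ≤ℕ i → ind i k ≡ 0ℚ
ind-≥ {i} {k} k≤i rewrite dec-false (i ℕ.<? k) (ℕ.≤⇒≯ k≤i) = refl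

ind-suc : ∀ {m} (i k : Fin m) → ind (toℕ i) (suc (toℕ k)) ≡ ind (toℕ i) (toℕ k) + e i k
ind-suc i k with Fin.<-cmp i k
... | tri< i<k i≢k _ = trans (ind-< (ℕ.m<n⇒m<1+n i<k))
  (sym (cong₂ _+_ (ind-< i<k) (e-≢ (i≢k ∘ sym))))
... | tri≈ _ refl _  = trans (ind-< {toℕ i} ℕ.≤-refl)
  (sym (cong₂ _+_ (ind-≥ {toℕ i} ℕ.≤-refl) (e-refl i)))
... | tri> _ i≢k i>k = trans (ind-≥ {toℕ i} i>k)
  (sym (cong₂ _+_ (ind-≥ {toℕ i} (ℕ.<⇒≤ i>k)) (e-≢ (i≢k ∘ sym))))

ind-antitone : ∀ {i j} k → i <ℕ j → 0ℚ ≤ ind i k - ind j k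
ind-antitone {i} {j} k i<j with i ℕ.<? k | j ℕ.<? k
... | yes i<k | yes j<k = ≤-reflexive (sym (cong₂ _-_ (ind-< i<k) (ind-< j<k)))
... | yes i<k | no j≮k  = ≤-trans 0≤1 (≤-reflexive (sym (cong₂ _-_ (ind-< i<k) (ind-≥ (ℕ.≮⇒≥ j≮k)))))
... | no i≮k  | yes j<k = contradiction (ℕ.<-trans i<j j<k) i≮k
... | no i≮k  | no j≮k  = ≤-reflexive (sym (cong₂ _-_ (ind-≥ (ℕ.≮⇒≥ i≮k)) (ind-≥ (ℕ.≮⇒≥ j≮k))))

module _ {n : ℕ} (τ : Fin (suc n) → ℕ) (τ-injective : ∀ {i j} → τ i ≡ τ j → i ≡ j) where

  open Scan τ τ-injective

  -- The pool just before vertex k holds the weight of the given arrows passing over that point.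
  straighten : ∀ {x ls F} → All (0ℚ ≤_) ls → All Forward F → comb ls F ≋ x → Plan x 0 x []
  straighten {x} {ls} {F} ls≥0 forward-F comb≡ = relax x
    (λ v → cong (_- 0ℚ) (trans (sum-cong (allFin (suc n)) (λ k → cong (x k *_) (e-sym k v))) (dot-e x v)))
    id
    (scan x id id (passing ∘ toℕ) (λ k → passing≥0 (toℕ k)) passing-end passing-step
      (valid [] []) (sym (wsum-0 ls F)) (λ _ → z≤n))
    where
    passing : ℕ → ℚ
    passing k = wsum (λ a → ind (toℕ (tail a)) k - ind (toℕ (head a)) k) ls F

    passing≥0 : ∀ k → 0ℚ ≤ passing k
    passing≥0 k = wsum-nonNeg ls≥0 (All.map (ind-antitone k) forward-F)

    passing-end : passing (toℕ (fromℕ (suc n))) ≡ 0ℚ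
    passing-end rewrite Fin.toℕ-fromℕ (suc n) = trans
      (wsum-cong′ ls F (λ a → cong₂ _-_ (ind-< (Fin.toℕ<n (tail a))) (ind-< (Fin.toℕ<n (head a)))))
      (wsum-0 ls F)

    passing-step : ∀ k → passing (suc (toℕ k)) ≡ passing (toℕ (inject₁ k)) - x k
    passing-step k rewrite Fin.toℕ-inject₁ k = trans
      (wsum-cong′ ls F (λ a → trans (cong₂ _-_ (ind-suc (tail a) k) (ind-suc (head a) k))
        (solve 4 (λ t et h eh → (t :+ et) :- (h :+ eh) := (t :- h) :- (eh :- et)) refl
          (ind (toℕ (tail a)) (toℕ k)) (e (tail a) k) (ind (toℕ (head a)) (toℕ k)) (e (head a) k))))
      (trans (wsum-- _ (λ a → pt a k) ls F) (cong (λ t → passing (toℕ k) - t) (comb≡ k)))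

    e-sym : ∀ {m} (i k : Fin m) → e i k ≡ e k i
    e-sym i k with i ≟ k
    ... | yes refl = e-refl i
    ... | no i≢k   = e-≢ (i≢k ∘ sym)

face-arrows : ∀ {n} (c : Vec (suc n)) (b : ℚ) → b ≢ 0ℚ → ∀ {ps} → All (FaceGen c b) ps →
  Σ (List (Arrow n)) λ F → All Forward F × All (λ a → c (head a) - c (tail a) ≡ b) F ×
    length F ≡ length ps × (∀ ls → comb ls F ≋ lincomb ls ps)
face-arrows c b b≢0 [] = [] , [] , [] , refl , λ { [] k → refl ; (_ ∷ _) k → refl }
face-arrows c b b≢0 {p ∷ _} ((inj₁ p≋0 , tight) ∷ _) =
  contradiction (trans (sym tight) (trans (dot-cong c {p} p≋0) (dot-zeroV c))) b≢0
face-arrows c b b≢0 {p ∷ _} ((inj₂ (a , a-forward , p≋a) , tight) ∷ gens)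
  with F , forward-F , tight-F , len , comb≡ ← face-arrows c b b≢0 gens
  = a ∷ F , a-forward ∷ forward-F ,
    trans (sym (trans (dot-cong c {p} p≋a) (dot-pt c a))) tight ∷ tight-F , cong suc len ,
    λ { [] k → refl ; (l ∷ ls) k → cong₂ _+_ (cong (l *_) (sym (p≋a k))) (comb≡ ls k) }

-- For the arrows produced by the scan, `c` gives heights at most `b`, which bounds their total
-- weight only from below. The indicator `h` of the heads of tight arrows gives an equality instead.
module TightHeads {n : ℕ} (c : Vec (suc n)) (b : ℚ) (b>0 : 0ℚ < b)
                  (bounded : ∀ {i j : Fin (suc n)} → i <ᶠ j → c j - c i ≤ b) where

  IsHead : Fin (suc n) → Set
  IsHead k = ∃ λ i → i <ᶠ k × c k - c i ≡ b

  isHead? : ∀ k → Dec (IsHead k)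
  isHead? k = Fin.any? (λ i → (i Fin.<? k) ×-dec (c k - c i ℚ.≟ b))

  h : Vec (suc n)
  h k = if does (isHead? k) then 1ℚ else 0ℚ

  h-head : ∀ {k} → IsHead k → h k ≡ 1ℚ
  h-head {k} is rewrite dec-true (isHead? k) is = refl

  h-tail : ∀ {k} → ¬ IsHead k → h k ≡ 0ℚ
  h-tail {k} isn't rewrite dec-false (isHead? k) isn't = refl

  Tight : Arrow n → Set
  Tight a = Forward a × c (head a) - c (tail a) ≡ b

  tight-head : ∀ {a} → Tight a → IsHead (head a)
  tight-head {t , _} (f , eq) = t , f , eq

  -- Two consecutive tight arrows would compose to a forward arrow of height `b + b`, above the
  -- bound.
  tight-tail : ∀ {a} → Tight a → ¬ IsHead (tail a)
  tight-tail {t , k} (t<k , k-t) (i , i<t , t-i) = <⇒≱ b+b>b (begin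
    b + b                       ≡⟨ cong₂ _+_ k-t t-i ⟨
    (c k - c t) + (c t - c i)   ≡⟨ solve 3 (λ k t i → (k :- t) :+ (t :- i) := k :- i) refl (c k) (c t) (c i) ⟩
    c k - c i                   ≤⟨ bounded (ℕ.<-trans i<t t<k) ⟩
    b                           ∎)
    where
    open ≤-Reasoning
    <⇒≱ : ∀ {p q} → p < q → ¬ (q ≤ p)
    <⇒≱ p<q q≤p = <-irrefl refl (<-≤-trans p<q q≤p)
    b+b>b : b < b + b
    b+b>b = ≤-<-trans (≤-reflexive (sym (+-identityʳ b))) (+-monoʳ-< b b>0)

  h-tight : ∀ {a} → Tight a → dot h (pt a) ≡ 1ℚ
  h-tight {a} tight = trans (dot-pt h a) (cong₂ _-_ (h-head (tight-head tight)) (h-tail (tight-tail tight)))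

  module _ {ls : List ℚ} {F : List (Arrow n)} (ls≥0 : All (0ℚ ≤_) ls) (tight : All Tight F)
           {x : Vec (suc n)} (comb≡ : comb ls F ≋ x) where

    positive⇒head : ∀ {k} → 0ℚ < x k → IsHead k
    positive⇒head {k} pos = decidable-stable (isHead? k) λ isn't → <-irrefl refl (<-≤-trans pos (begin
      x k                      ≡⟨ comb≡ k ⟨
      comb ls F k              ≤⟨ wsum-mono ls≥0 (All.map (nonpositive isn't) tight) ⟩
      wsum (λ _ → 0ℚ) ls F     ≡⟨ wsum-0 ls F ⟩
      0ℚ                       ∎))
      where
      open ≤-Reasoning
      nonpositive : ¬ IsHead k → ∀ {a} → Tight a → pt a k ≤ 0ℚ
      nonpositive isn't {a} t = ≤-trans
        (≤-reflexive (cong (_- e (tail a) k) (e-≢ {i = head a} {k} λ { refl → isn't (tight-head t) })))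
        (≤-trans (≤-reflexive (+-identityˡ _)) (neg-antimono-≤ (e≥0 (tail a) k)))

    negative⇒tail : ∀ {k} → x k < 0ℚ → ¬ IsHead k
    negative⇒tail {k} neg is = <-irrefl refl (<-≤-trans neg (begin
      0ℚ                       ≡⟨ wsum-0 ls F ⟨
      wsum (λ _ → 0ℚ) ls F     ≤⟨ wsum-mono ls≥0 (All.map nonnegative tight) ⟩
      comb ls F k              ≡⟨ comb≡ k ⟩
      x k                      ∎))
      where
      open ≤-Reasoning
      nonnegative : ∀ {a} → Tight a → 0ℚ ≤ pt a k
      nonnegative {a} t = ≤-trans (e≥0 (head a) k) (≤-reflexive (sym (trans
        (cong (λ q → e (head a) k - q) (e-≢ {i = tail a} {k} λ { refl → tight-tail t is }))
        (+-identityʳ _))))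

    -- Every arrow from a negative to a positive coordinate of x has height 1 under h, so any two
    -- such decompositions of x have the same total weight.
    same-sum : ∀ {ms G} → length ls ≡ length F → length ms ≡ length G →
      All (λ a → x (tail a) < 0ℚ × 0ℚ < x (head a)) G → comb ms G ≋ x → sumℚ ms ≡ sumℚ ls
    same-sum {ms} {G} lenF lenG signs comb≡′ = trans
      (height-sum h pt {ms} {G} lenG
        (All.map (λ {a} (neg , pos) → trans (dot-pt h a)
          (cong₂ _-_ (h-head (positive⇒head pos)) (h-tail (negative⇒tail neg)))) signs) comb≡′)
      (sym (height-sum h pt {ls} {F} lenF (All.map h-tight tight) comb≡))

allPairs-with : {A : Set} {P : A → Set} {R S : A → A → Set} {xs : List A} →
  (∀ {a b} → P a → P b → R a b → S a b) → All P xs → AllPairs R xs → AllPairs S xs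
allPairs-with f []         []         = []
allPairs-with f (pa ∷ ps) (ra ∷ rs) =
  All.zipWith (λ (pb , r) → f pa pb r) (ps , ra) ∷ allPairs-with f ps rs

outer-boundary-covered : ∀ {n} {E : Arrow n → Arrow n → Set} {τ : Fin (suc n) → ℕ} →
  (∀ {i j} → τ i ≡ τ j → i ≡ j) → Rule τ E → Symmetric E → Permissible E → THTHDoesNotNest E →
  ∀ x → InOuterBoundary x → Σ (List (Arrow n)) λ F → IsFace⁺ E F × InConv (simplex F) x
outer-boundary-covered {n} {E} {τ} τ-injective rule symmetric permissible noNest x
  (c , b , (valid-ineq , _) , origin-outside , ps , gens , ls , len , ls≥0 , sum≡1 , ls≡x) =
  cover (face-arrows c b b≢0 gens)
  where
  dot-origin≡0 : dot c zeroV ≡ 0ℚ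
  dot-origin≡0 = dot-zeroV c
  b≢0 : b ≢ 0ℚ
  -- For `b` equal to 0 the origin would itself be a generator on the face.
  b≢0 refl = origin-outside (zeroV ∷ [] , (inj₁ (λ _ → refl) , dot-origin≡0) ∷ [] ,
    1ℚ ∷ [] , refl , 0≤1 ∷ [] , refl , λ _ → refl)
  b>0 : 0ℚ < b
  b>0 = ≰⇒> λ b≤0 → b≢0 (≤-antisym b≤0
    (≤-trans (≤-reflexive (sym dot-origin≡0)) (valid-ineq zeroV (inj₁ λ _ → refl))))
  bounded : ∀ {i j} → i <ᶠ j → c j - c i ≤ b
  bounded {i} {j} i<j = ≤-trans (≤-reflexive (sym (dot-pt c (i , j))))
    (valid-ineq (pt (i , j)) (inj₂ ((i , j) , i<j , λ _ → refl)))
  open TightHeads c b b>0 bounded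

  cover : (Σ (List (Arrow n)) λ F → All Forward F × All (λ a → c (head a) - c (tail a) ≡ b) F ×
      length F ≡ length ps × (∀ ls → comb ls F ≋ lincomb ls ps)) →
    Σ (List (Arrow n)) λ F → IsFace⁺ E F × InConv (simplex F) x
  cover (F , forward-F , tight-F , lenF , comb-F≡)
    with Scan.plan ms G lenG ms≥0 meets placed later ←
           straighten τ τ-injective ls≥0 forward-F (λ k → trans (comb-F≡ ls k) (ls≡x k))
    = G , ((All.map (λ (f , _) → Fin.<⇒≢ f) placed , AllPairs.map later⇒≢ later ,
        allPairs-with edge placed later) , All.map proj₁ placed) ,
      ms , trans lenG (sym (length-map pt G)) , ms≥0 ,
      trans (same-sum ls≥0 (All.zip (forward-F , tight-F)) (λ k → trans (comb-F≡ ls k) (ls≡x k))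
        {ms} {G} (trans len (sym lenF)) lenG
          (All.map (λ (_ , neg , pos , _) → neg , pos) placed) comb≡) sum≡1 ,
      λ k → trans (wsum-map (λ p → p k) pt ms G) (comb≡ k)
    where
    comb≡ : comb ms G ≋ x
    comb≡ k = trans (meets k) (+-identityʳ (x k))
    later⇒≢ : ∀ {a b} → Later τ a b → a ≢ b
    later⇒≢ (inj₁ (_ , lt)) refl = ℕ.<-irrefl refl lt
    later⇒≢ (inj₂ (lt , _)) refl = ℕ.<-irrefl refl lt
    -- Heads sit at positive and tails at negative coordinates of `x`, so the head of `a` is not the
    -- tail of `b`.
    edge : ∀ {a b} → Scan.Placed τ τ-injective x 0 [] a → Scan.Placed τ τ-injective x 0 [] b →
      Later τ a b → E a b
    edge (fa , _ , pos , _) (fb , neg , _) = later⇒edge τ-injective rule symmetric permissible noNest fa fb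
      λ eq → <-asym pos (subst (λ k → x k < 0ℚ) (sym eq) neg)

theorem3p8 : (n : ℕ) (E : Arrow n → Arrow n → Set) →
    Symmetric E → Permissible E → Uniform E → THTHDoesNotNest E →
    RepresentsTriangulation E InOuterBoundary
theorem3p8 n E symmetric permissible uniform noNest
  with τ , τ-injective , rule ← priority n symmetric permissible uniform
  = (λ F face ls len _ → simplex-independent τ-injective (uncross face) (unique face) ls len) ,
    (λ F face → uncrossed-in-outer-boundary (uncross face)) ,
    outer-boundary-covered τ-injective rule symmetric permissible noNest ,
    (λ F G faceF faceG → common-face τ-injective (uncross faceF) (uncross faceG) (unique faceF))
  where
  uncross : ∀ {F} → IsFace⁺ E F → Uncrossed τ F
  uncross = face-uncrossed τ-injective rule symmetric permissible
  unique : ∀ {F} → IsFace⁺ E F → Unique F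
  unique ((_ , u , _) , _) = u
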